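{- $A_{\text{gen}}(n) = O(n^{\log_2 7})$ as $n \to \infty$.
   Context: For a finite set $\mathcal P \subset \mathbb{R}^2$, $A(\mathcal P)$ denotes the number of distinct values in the open interval $(0,\pi)$ of angles $\angle pqr$ with $p,q,r$ distinct points of $\mathcal P$ (angles of $0$ and $\pi$ are not counted). A planar point set is in general position if no three of its points are collinear and no four of its points lie on a common circle. $A_{\text{gen}}(n)$ is the minimum of $A(\mathcal P)$ over all sets $\mathcal P \subset \mathbb{R}^2$ of $n$ points in general position. $f = O(g)$ means there is a constant $C$ with $f(n) \le C g(n)$ for all sufficiently large $n$. -}

module Defs where

open import Level using (0ℓ)
open import Algebra.Bundles using (RawRing)
import Algebra.Definitions.RawSemiring as RawSemiringDefs
open import Data.Fin.Base using (Fin; toℕ)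
open import Data.Integer.Base using (+_; -[1+_])
import Data.Integer.Base as ℤ
open import Data.Nat.Base as ℕ using (ℕ; suc; _!)
import Data.Nat.Properties as ℕ
open import Data.Product using (Σ; ∃-syntax; _×_; _,_)
open import Data.Rational.Base as ℚ using (ℚ; mkℚ; 0ℚ; 1ℚ; ½)
import Data.Rational.Properties as ℚ
open import Data.Rational.Solver using (module +-*-Solver)
open import Function.Definitions using (Injective)
open import Relation.Binary.PropositionalEquality
  using (_≡_; _≢_; refl; sym; trans; cong; subst; subst₂)
open import Relation.Nullary.Negation using (¬_)

------------------------------------------------------------------------
-- Real numbers: Cauchy sequences of rationals, equal when their
-- difference tends to zero.

IsCauchy : (ℕ → ℚ) → Set
IsCauchy x = ∀ ε → 0ℚ ℚ.< ε →
  ∃[ N ] ∀ m n → N ℕ.≤ m → N ℕ.≤ n → ℚ.∣ x m ℚ.- x n ∣ ℚ.≤ ε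

record ℝ : Set where
  constructor mkℝ
  field
    seq    : ℕ → ℚ
    cauchy : IsCauchy seq

open ℝ public

private abstract
  regroup-+ : ∀ a b c d → (a ℚ.+ b) ℚ.- (c ℚ.+ d) ≡ (a ℚ.- c) ℚ.+ (b ℚ.- d)
  regroup-+ = solve 4 (λ a b c d → (a :+ b) :- (c :+ d) := (a :- c) :+ (b :- d)) refl
    where open +-*-Solver

  regroup-* : ∀ a b c d → a ℚ.* b ℚ.- c ℚ.* d ≡ a ℚ.* (b ℚ.- d) ℚ.+ d ℚ.* (a ℚ.- c)
  regroup-* = solve 4 (λ a b c d → a :* b :- c :* d := a :* (b :- d) :+ d :* (a :- c)) refl
    where open +-*-Solver

  regroup-- : ∀ a b → a ≡ (a ℚ.- b) ℚ.+ b
  regroup-- = solve 2 (λ a b → a := (a :- b) :+ b) refl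
    where open +-*-Solver

  half : ∀ ε → ε ℚ.* ½ ℚ.+ ε ℚ.* ½ ≡ ε
  half ε = trans (sym (ℚ.*-distribˡ-+ ε ½ ½)) (ℚ.*-identityʳ ε)

  half-pos : ∀ {ε} → 0ℚ ℚ.< ε → 0ℚ ℚ.< ε ℚ.* ½
  half-pos {ε} 0<ε = subst (ℚ._< ε ℚ.* ½) (ℚ.*-zeroˡ ½) (ℚ.*-monoˡ-<-pos ½ 0<ε)

  +-cauchy : ∀ x y → IsCauchy x → IsCauchy y → IsCauchy (λ n → x n ℚ.+ y n)
  +-cauchy x y cx cy ε 0<ε with cx (ε ℚ.* ½) (half-pos 0<ε) | cy (ε ℚ.* ½) (half-pos 0<ε)
  ... | M , hx | N , hy = M ℕ.+ N , λ m n m≥ n≥ → begin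
    ℚ.∣ (x m ℚ.+ y m) ℚ.- (x n ℚ.+ y n) ∣
      ≡⟨ cong ℚ.∣_∣ (regroup-+ (x m) (y m) (x n) (y n)) ⟩
    ℚ.∣ (x m ℚ.- x n) ℚ.+ (y m ℚ.- y n) ∣
      ≤⟨ ℚ.∣p+q∣≤∣p∣+∣q∣ (x m ℚ.- x n) (y m ℚ.- y n) ⟩
    ℚ.∣ x m ℚ.- x n ∣ ℚ.+ ℚ.∣ y m ℚ.- y n ∣
      ≤⟨ ℚ.+-mono-≤
           (hx m n (ℕ.≤-trans (ℕ.m≤m+n M N) m≥) (ℕ.≤-trans (ℕ.m≤m+n M N) n≥))
           (hy m n (ℕ.≤-trans (ℕ.m≤n+m N M) m≥) (ℕ.≤-trans (ℕ.m≤n+m N M) n≥)) ⟩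
    ε ℚ.* ½ ℚ.+ ε ℚ.* ½
      ≡⟨ half ε ⟩
    ε ∎
    where open ℚ.≤-Reasoning

  neg-cauchy : ∀ x → IsCauchy x → IsCauchy (λ n → ℚ.- x n)
  neg-cauchy x cx ε 0<ε with cx ε 0<ε
  ... | N , hx = N , λ m n m≥ n≥ → subst (ℚ._≤ ε)
    (trans (sym (ℚ.∣-p∣≡∣p∣ (x m ℚ.- x n)))
      (cong ℚ.∣_∣ (ℚ.neg-distrib-+ (x m) (ℚ.- x n))))
    (hx m n m≥ n≥)

  0<1 : 0ℚ ℚ.< 1ℚ
  0<1 = ℚ.positive⁻¹ 1ℚ

  eventually-bounded : ∀ x → IsCauchy x →
    ∃[ N ] ∃[ B ] 0ℚ ℚ.< B × (∀ n → N ℕ.≤ n → ℚ.∣ x n ∣ ℚ.≤ B)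
  eventually-bounded x cx with cx 1ℚ 0<1
  ... | N , hx = N , 1ℚ ℚ.+ ℚ.∣ x N ∣ , ℚ.+-mono-<-≤ 0<1 (ℚ.0≤∣p∣ (x N)) , λ n n≥ → begin
    ℚ.∣ x n ∣
      ≡⟨ cong ℚ.∣_∣ (regroup-- (x n) (x N)) ⟩
    ℚ.∣ (x n ℚ.- x N) ℚ.+ x N ∣
      ≤⟨ ℚ.∣p+q∣≤∣p∣+∣q∣ (x n ℚ.- x N) (x N) ⟩
    ℚ.∣ x n ℚ.- x N ∣ ℚ.+ ℚ.∣ x N ∣
      ≤⟨ ℚ.+-monoˡ-≤ ℚ.∣ x N ∣ (hx n N n≥ ℕ.≤-refl) ⟩
    1ℚ ℚ.+ ℚ.∣ x N ∣ ∎
    where open ℚ.≤-Reasoning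

  *-mono-∣∣ : ∀ p q {a b} → ℚ.∣ p ∣ ℚ.≤ a → 0ℚ ℚ.< a → ℚ.∣ q ∣ ℚ.≤ b →
              ℚ.∣ p ℚ.* q ∣ ℚ.≤ a ℚ.* b
  *-mono-∣∣ p q {a} {b} p≤a 0<a q≤b = begin
    ℚ.∣ p ℚ.* q ∣         ≡⟨ ℚ.∣p*q∣≡∣p∣*∣q∣ p q ⟩
    ℚ.∣ p ∣ ℚ.* ℚ.∣ q ∣   ≤⟨ ℚ.*-monoʳ-≤-nonNeg ℚ.∣ q ∣ {{ℚ.nonNegative (ℚ.0≤∣p∣ q)}} p≤a ⟩
    a ℚ.* ℚ.∣ q ∣         ≤⟨ ℚ.*-monoˡ-≤-nonNeg a {{ℚ.nonNegative (ℚ.<⇒≤ 0<a)}} q≤b ⟩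
    a ℚ.* b ∎
    where open ℚ.≤-Reasoning

  reciprocal : ∀ s → 0ℚ ℚ.< s → ∃[ r ] 0ℚ ℚ.< r × s ℚ.* r ≡ 1ℚ
  reciprocal s 0<s =
    (ℚ.1/ s) {{s≢0}} , ℚ.positive⁻¹ ((ℚ.1/ s) {{s≢0}}) {{ℚ.1/pos⇒pos s {{s⁺}}}} ,
    ℚ.*-inverseʳ s {{s≢0}}
    where
    s⁺ : ℚ.Positive s
    s⁺ = ℚ.positive 0<s
    s≢0 : ℚ.NonZero s
    s≢0 = ℚ.pos⇒nonZero s {{s⁺}}

  divide : ∀ s → 0ℚ ℚ.< s → ∀ ε → 0ℚ ℚ.< ε → ∃[ δ ] 0ℚ ℚ.< δ × s ℚ.* δ ≡ ε
  divide s 0<s ε 0<ε =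
    let r , 0<r , sr≡1 = reciprocal s 0<s
    in r ℚ.* ε ,
       subst (ℚ._< r ℚ.* ε) (ℚ.*-zeroʳ r) (ℚ.*-monoʳ-<-pos r {{ℚ.positive 0<r}} 0<ε) ,
       trans (sym (ℚ.*-assoc s r ε)) (trans (cong (ℚ._* ε) sr≡1) (ℚ.*-identityˡ ε))

  product-bound : ∀ a b c d {A B δ} → ℚ.∣ a ∣ ℚ.≤ A → 0ℚ ℚ.< A → ℚ.∣ d ∣ ℚ.≤ B → 0ℚ ℚ.< B →
    ℚ.∣ a ℚ.- c ∣ ℚ.≤ δ → ℚ.∣ b ℚ.- d ∣ ℚ.≤ δ →
    ℚ.∣ a ℚ.* b ℚ.- c ℚ.* d ∣ ℚ.≤ (A ℚ.+ B) ℚ.* δ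
  product-bound a b c d {A} {B} {δ} a≤A 0<A d≤B 0<B ac bd =
    subst₂ ℚ._≤_ (cong ℚ.∣_∣ (sym (regroup-* a b c d))) (sym (ℚ.*-distribʳ-+ δ A B))
      (ℚ.≤-trans (ℚ.∣p+q∣≤∣p∣+∣q∣ (a ℚ.* (b ℚ.- d)) (d ℚ.* (a ℚ.- c)))
        (ℚ.+-mono-≤ {ℚ.∣ a ℚ.* (b ℚ.- d) ∣} {A ℚ.* δ} {ℚ.∣ d ℚ.* (a ℚ.- c) ∣} {B ℚ.* δ}
          (*-mono-∣∣ a (b ℚ.- d) a≤A 0<A bd)
          (*-mono-∣∣ d (a ℚ.- c) d≤B 0<B ac)))

  product-cauchy : ∀ (x y : ℕ → ℚ) {A B δ} →
    (∃[ K ] ∀ n → K ℕ.≤ n → ℚ.∣ x n ∣ ℚ.≤ A) → 0ℚ ℚ.< A →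
    (∃[ L ] ∀ n → L ℕ.≤ n → ℚ.∣ y n ∣ ℚ.≤ B) → 0ℚ ℚ.< B →
    (∃[ M ] ∀ m n → M ℕ.≤ m → M ℕ.≤ n → ℚ.∣ x m ℚ.- x n ∣ ℚ.≤ δ) →
    (∃[ N ] ∀ m n → N ℕ.≤ m → N ℕ.≤ n → ℚ.∣ y m ℚ.- y n ∣ ℚ.≤ δ) →
    ∃[ N ] ∀ m n → N ℕ.≤ m → N ℕ.≤ n →
      ℚ.∣ x m ℚ.* y m ℚ.- x n ℚ.* y n ∣ ℚ.≤ (A ℚ.+ B) ℚ.* δ
  product-cauchy x y (K , hA) 0<A (L , hB) 0<B (M , hx) (N , hy) =
    (K ℕ.⊔ L) ℕ.⊔ (M ℕ.⊔ N) , λ m n m≥ n≥ →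
      let KL≤m = ℕ.m⊔n≤o⇒m≤o (K ℕ.⊔ L) (M ℕ.⊔ N) m≥
          MN≤m = ℕ.m⊔n≤o⇒n≤o (K ℕ.⊔ L) (M ℕ.⊔ N) m≥
          KL≤n = ℕ.m⊔n≤o⇒m≤o (K ℕ.⊔ L) (M ℕ.⊔ N) n≥
          MN≤n = ℕ.m⊔n≤o⇒n≤o (K ℕ.⊔ L) (M ℕ.⊔ N) n≥
      in product-bound (x m) (y m) (x n) (y n)
           (hA m (ℕ.m⊔n≤o⇒m≤o K L KL≤m)) 0<A
           (hB n (ℕ.m⊔n≤o⇒n≤o K L KL≤n)) 0<B
           (hx m n (ℕ.m⊔n≤o⇒m≤o M N MN≤m) (ℕ.m⊔n≤o⇒m≤o M N MN≤n))
           (hy m n (ℕ.m⊔n≤o⇒n≤o M N MN≤m) (ℕ.m⊔n≤o⇒n≤o M N MN≤n))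

  *-cauchy : ∀ x y → IsCauchy x → IsCauchy y → IsCauchy (λ n → x n ℚ.* y n)
  *-cauchy x y cx cy ε 0<ε =
    let K , A , 0<A , hA = eventually-bounded x cx
        L , B , 0<B , hB = eventually-bounded y cy
        δ , 0<δ , eq = divide (A ℚ.+ B) (ℚ.+-mono-< 0<A 0<B) ε 0<ε
    in subst
         (λ e → ∃[ N ] ∀ m n → N ℕ.≤ m → N ℕ.≤ n →
           ℚ.∣ x m ℚ.* y m ℚ.- x n ℚ.* y n ∣ ℚ.≤ e) eq
         (product-cauchy x y (K , hA) 0<A (L , hB) 0<B (cx δ 0<δ) (cy δ 0<δ))

fromℚ : ℚ → ℝ
seq    (fromℚ q) _ = q
cauchy (fromℚ q) ε 0<ε =
  0 , λ _ _ _ _ → subst (ℚ._≤ ε) (cong ℚ.∣_∣ (sym (ℚ.+-inverseʳ q))) (ℚ.<⇒≤ 0<ε)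

fromℕ : ℕ → ℝ
fromℕ n = fromℚ (+ n ℚ./ 1)

infixl 6 _+_ _-_
infixl 7 _*_
infix  8 -_

_+_ _*_ : ℝ → ℝ → ℝ

seq    (x + y) n = seq x n ℚ.+ seq y n
cauchy (x + y)   = +-cauchy (seq x) (seq y) (cauchy x) (cauchy y)

seq    (x * y) n = seq x n ℚ.* seq y n
cauchy (x * y)   = *-cauchy (seq x) (seq y) (cauchy x) (cauchy y)

-_ : ℝ → ℝ
seq    (- x) n = ℚ.- seq x n
cauchy (- x)   = neg-cauchy (seq x) (cauchy x)

_-_ : ℝ → ℝ → ℝ
x - y = x + (- y)

infix 4 _≈_ _<_ _≤_

_≈_ _<_ _≤_ : ℝ → ℝ → Set
x ≈ y = ∀ ε → 0ℚ ℚ.< ε → ∃[ N ] ∀ n → N ℕ.≤ n → ℚ.∣ seq x n ℚ.- seq y n ∣ ℚ.≤ ε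
x < y = ∃[ ε ] 0ℚ ℚ.< ε × ∃[ N ] ∀ n → N ℕ.≤ n → seq x n ℚ.+ ε ℚ.≤ seq y n
x ≤ y = ¬ (y < x)

ℝ-rawRing : RawRing 0ℓ 0ℓ
ℝ-rawRing = record
  { Carrier = ℝ
  ; _≈_ = _≈_
  ; _+_ = _+_
  ; _*_ = _*_
  ; -_  = -_
  ; 0#  = fromℕ 0
  ; 1#  = fromℕ 1
  }

open RawSemiringDefs (RawRing.rawSemiring ℝ-rawRing) public using (_^_; sum)

infix 4 _⟶_

_⟶_ : (ℕ → ℝ) → ℝ → Set
xs ⟶ l = ∀ ε → 0ℚ ℚ.< ε →
  ∃[ N ] ∀ n → N ℕ.≤ n → (l - fromℚ ε < xs n) × (xs n < l + fromℚ ε)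

IsLUB : (ℝ → Set) → ℝ → Set
IsLUB S y = (∀ z → S z → z ≤ y) × (∀ w → (∀ z → S z → z ≤ w) → y ≤ w)

------------------------------------------------------------------------
-- Functions whose totality on ℝ is classical or needs a convergence
-- proof are given by their graphs:  IsF x y  reads  "y = F x".

-- cos θ = Σₖ (-1)ᵏ θ²ᵏ / (2k)!

cosTerm : ℝ → ℕ → ℝ
cosTerm θ k =
  fromℚ (((ℤ.-1ℤ ℤ.^ k) ℚ./ ((2 ℕ.* k) !)) {{(2 ℕ.* k) ℕ.!≢0}}) * θ ^ (2 ℕ.* k)

IsCos : ℝ → ℝ → Set
IsCos θ c = (λ n → sum {n} (λ k → cosTerm θ (toℕ k))) ⟶ c

-- The principal value of the arccosine: since cos decreases on [0,π], it
-- is the least nonnegative number whose cosine is c.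

IsArccos : ℝ → ℝ → Set
IsArccos c θ = fromℕ 0 ≤ θ × IsCos θ c ×
  (∀ φ → fromℕ 0 ≤ φ → IsCos φ c → θ ≤ φ)

IsPi : ℝ → Set
IsPi = IsArccos (- fromℕ 1)

-- IsRatPow b t z  says  z = bᵗ  for b > 0: the positive solution of
-- zᵠ = bᵖ, where t = p/q; for p < 0 this is written zᵠ b⁻ᵖ = 1.

IsRatPow : ℝ → ℚ → ℝ → Set
IsRatPow b (mkℚ (+ p)    q-1 _) z =
  fromℕ 0 < z × z ^ suc q-1 ≈ b ^ p
IsRatPow b (mkℚ -[1+ p ] q-1 _) z =
  fromℕ 0 < z × z ^ suc q-1 * b ^ suc p ≈ fromℕ 1

-- IsPow b x y  says  y = bˣ, where bˣ = sup { bᵗ ∣ t ∈ ℚ, t ≤ x }.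
-- This is the real power for bases b ≥ 1 only.

IsPow : ℝ → ℝ → ℝ → Set
IsPow b x = IsLUB (λ z → ∃[ t ] fromℚ t ≤ x × IsRatPow b t z)

-- IsLog b y x  says  x = log_b y, for b > 1.

IsLog : ℝ → ℝ → ℝ → Set
IsLog b y x = IsPow b x y

------------------------------------------------------------------------
-- The plane

Point : Set
Point = ℝ × ℝ

infix 4 _≈ₚ_

_≈ₚ_ : Point → Point → Set
(x , y) ≈ₚ (x′ , y′) = x ≈ x′ × y ≈ y′

infixl 6 _-ₚ_

_-ₚ_ : Point → Point → Point
(x , y) -ₚ (x′ , y′) = (x - x′) , (y - y′)

infixl 7 _∙_

_∙_ : Point → Point → ℝ
(x , y) ∙ (x′ , y′) = x * x′ + y * y′

IsNorm : Point → ℝ → Set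
IsNorm u r = fromℕ 0 ≤ r × r * r ≈ u ∙ u

-- θ = ∠pqr = arccos ((p - q) ∙ (r - q) / (|p - q| |r - q|))

IsAngle : Point → Point → Point → ℝ → Set
IsAngle p q r θ = ∃[ a ] ∃[ b ] ∃[ c ]
  IsNorm (p -ₚ q) a × IsNorm (r -ₚ q) b ×
  c * (a * b) ≈ (p -ₚ q) ∙ (r -ₚ q) × IsArccos c θ

OnLine : (a b c : ℝ) → Point → Set
OnLine a b c (x , y) = a * x + b * y ≈ c

Collinear : Point → Point → Point → Set
Collinear p q r = ∃[ a ] ∃[ b ] ∃[ c ]
  ¬ (a ≈ fromℕ 0 × b ≈ fromℕ 0) ×
  OnLine a b c p × OnLine a b c q × OnLine a b c r

OnCircle : (centre : Point) (radius : ℝ) → Point → Set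
OnCircle o r p = IsNorm (p -ₚ o) r

Concyclic : Point → Point → Point → Point → Set
Concyclic p q r s = ∃[ o ] ∃[ ρ ] fromℕ 0 < ρ ×
  OnCircle o ρ p × OnCircle o ρ q × OnCircle o ρ r × OnCircle o ρ s

------------------------------------------------------------------------
-- Point sets and their angles

record PointSet (n : ℕ) : Set where
  field
    point    : Fin n → Point
    distinct : Injective _≡_ _≈ₚ_ point

open PointSet public

Distinct₃ : ∀ {n} → Fin n → Fin n → Fin n → Set
Distinct₃ i j k = i ≢ j × i ≢ k × j ≢ k

Distinct₄ : ∀ {n} → Fin n → Fin n → Fin n → Fin n → Set
Distinct₄ i j k l = Distinct₃ i j k × i ≢ l × j ≢ l × k ≢ l

GeneralPosition : ∀ {n} → PointSet n → Set
GeneralPosition P =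
  (∀ i j k → Distinct₃ i j k →
     ¬ Collinear (point P i) (point P j) (point P k)) ×
  (∀ i j k l → Distinct₄ i j k l →
     ¬ Concyclic (point P i) (point P j) (point P k) (point P l))

AngleValue : ∀ {n} → PointSet n → ℝ → Set
AngleValue P θ =
  (fromℕ 0 < θ × ∃[ π ] IsPi π × θ < π) ×
  ∃[ i ] ∃[ j ] ∃[ k ] Distinct₃ i j k ×
    IsAngle (point P i) (point P j) (point P k) θ

HasCardinality : (ℝ → Set) → ℕ → Set
HasCardinality S k = Σ (Fin k → ℝ) λ v →
  Injective _≡_ _≈_ v × (∀ i → S (v i)) × (∀ x → S x → ∃[ i ] x ≈ v i)

-- IsA P k  says  A(P) = k.

IsA : ∀ {n} → PointSet n → ℕ → Set
IsA P = HasCardinality (AngleValue P)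

-- IsAgen n m  says  A_gen(n) = m.  Constructively such an m exists only
-- up to double negation, since equality of reals is undecidable.

IsAgen : ℕ → ℕ → Set
IsAgen n m =
  (Σ (PointSet n) λ P → GeneralPosition P × IsA P m) ×
  (∀ (P : PointSet n) k → GeneralPosition P → IsA P k → m ℕ.≤ k)

{-# OPTIONS --safe #-}
-- Project the cube {0,1}ᵈ to the plane by x ↦ Σ xᵢ vᵢ.  The angle at y of
-- x, y, z depends only on the pair (x - y , z - y), which has seven possible
-- values in each coordinate, so there are at most 7ᵈ angles.  For generic vᵢ
-- the projected points are in general position: with v₁ , … , v_{i-1} chosen,
-- each collinearity or concyclicity among the points of the next cube is a
-- nontrivial polynomial condition on vᵢ of degree at most 2, and is violated
-- at vᵢ = (k , k³) for all large k.  Taking 2ᵈ⁻¹ ≤ n < 2ᵈ gives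
-- A_gen(n) ≤ 7ᵈ ≤ 7 n^(log₂ 7).
module Submission where

open import Defs
open import Algebra.Bundles using (CommutativeRing)
import Algebra.Properties.CommutativeSemiring.Exp as Exp
open import Data.Fin.Base using (Fin; zero; suc; toℕ; combine; remQuot; inject≤)
open import Data.Fin.Patterns using (0F; 1F; 2F; 3F; 4F; 5F; 6F)
import Data.Fin.Properties as Fin
open import Data.Integer.Base as ℤ using (ℤ; +_; -[1+_]; 0ℤ; 1ℤ)
import Data.Integer.Properties as ℤ
import Data.Integer.Solver as ℤSolver
open import Data.List.Base using (List; []; _∷_)
open import Data.List.Relation.Unary.All as All using (All; []; _∷_)
open import Data.List.Relation.Unary.All.Properties using (All¬⇒¬Any)
open import Data.List.Relation.Unary.Any using (Any; here; there)
open import Data.Nat.Base as ℕ using (ℕ; zero; suc)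
open import Data.Nat.Coprimality using (Coprime)
import Data.Nat.Properties as ℕ
open import Data.Product using (∃-syntax; _×_; _,_; proj₁; proj₂; map₂)
open import Data.Rational.Base as ℚ using (ℚ; 0ℚ; 1ℚ; ½; mkℚ)
import Data.Rational.Properties as ℚ
import Data.Rational.Solver as ℚSolver
import Data.Rational.Unnormalised.Base as ℚᵘ
import Data.Rational.Unnormalised.Properties as ℚᵘ
open import Data.Sum.Base using (inj₁; inj₂)
open import Data.Vec.Base using (Vec; []; _∷_)
import Data.Vec.Properties as Vec
open import Function.Base using (_∘_)
open import Relation.Binary.PropositionalEquality
open import Relation.Nullary using (¬_; Dec; yes; no; contradiction)
open import Relation.Nullary.Decidable using (¬?; ¬¬-excluded-middle)

open Exp (CommutativeRing.commutativeSemiring ℚ.+-*-commutativeRing) using ()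
  renaming (_^_ to _^ℚ_; ^-distrib-* to ^ℚ-distrib-*; ^-assocʳ to ^ℚ-assocʳ)

-- The `vᵢ` are integer vectors, so general position is the nonvanishing of finitely many integer
-- determinants, and each choice is that of one integer parameter beyond a threshold. Only
-- afterwards are these determinants confronted with lines and circles that have real coefficients.
-- The delicate case is a quadruple with two vertices in each half of the new cube: it may be a
-- parallelogram, as every 2-dimensional face is, and a parallelogram is concyclic when it is a
-- rectangle. There the induction hypothesis offers only distinctness, which must suffice to make
-- the condition nontrivial. Equality of reals is undecidable, so counting angle values and
-- minimising over point sets happen under a double negation, where excluded middle is available.
-- The numbers log₂ 7 and n^(log₂ 7) are given only as suprema over rational exponents, so the
-- growth estimate compares rational powers and never constructs either number.

module Determinants {A : Set} (_+_ _*_ : A → A → A) (-_ : A → A) where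
  infixl 6 _⊖_ _⊟_ _⊞_

  _⊖_ : A → A → A
  x ⊖ y = x + (- y)

  _⊟_ _⊞_ : A × A → A × A → A × A
  (a , b) ⊟ (c , d) = (a ⊖ c) , (b ⊖ d)
  (a , b) ⊞ (c , d) = (a + c) , (b + d)

  ⊟_ : A × A → A × A
  ⊟ (a , b) = (- a) , (- b)

  dot cross : A × A → A × A → A
  dot (a , b) (c , d) = (a * c) + (b * d)
  cross (a , b) (c , d) = (a * d) ⊖ (b * c)

  sq : A × A → A
  sq u = dot u u

  -- The determinant with rows (|u|² , u), (|v|² , v), (|w|² , w).
  triple : A × A → A × A → A × A → A
  triple u v w = ((sq u * cross v w) ⊖ (sq v * cross u w)) + (sq w * cross u v)

  det₃ : A × A → A × A → A × A → A
  det₃ p q r = cross (q ⊟ p) (r ⊟ p)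

  -- The in-circle determinant with `p` moved to the origin; it vanishes when the four points share
  -- a circle or a line.
  det₄ : A × A → A × A → A × A → A × A → A
  det₄ p q r s = triple (q ⊟ p) (r ⊟ p) (s ⊟ p)

  -- `z` is the zero of `A`, which the module parameters do not supply.
  horner : A → List A → A → A
  horner z []       x = z
  horner z (c ∷ cs) x = c + (x * horner z cs x)

  -- On the curve (x , x³) the monomials 1, X, Y, X², XY, Y² have distinct
  -- degrees, so a nonzero polynomial in X, Y of degree at most 2 does not
  -- vanish identically on it.
  curve : A → A × A
  curve x = x , (x * (x * x))

  line-coeffs : A → A × A → A × A → List A
  line-coeffs z u@(u₁ , u₂) r = cross u r ∷ (- u₂) ∷ z ∷ u₁ ∷ []

  -- The subscripts count the points left in place, among them the base point of `det₄`, and the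
  -- points moved by `curve x`. Writing (X , Y) for `curve x`, only the last row is quadratic,
  -- through `sq`: the quadratic part is `cross u v` times X² + Y², of degrees 2 and 6 in `x`.
  circle-coeffs₃₁ : A → A × A → A × A → A × A → List A
  circle-coeffs₃₁ z u@(u₁ , u₂) v@(v₁ , v₂) r@(r₁ , r₂) =
    triple u v r ∷
    (((sq v * u₂) ⊖ (sq u * v₂)) + ((r₁ + r₁) * cross u v)) ∷
    cross u v ∷
    (((sq u * v₁) ⊖ (sq v * u₁)) + ((r₂ + r₂) * cross u v)) ∷
    z ∷
    z ∷
    cross u v ∷ []

  -- With `c = curve x = (X , Y)`, the cubic terms `sq c * cross u c` of the two moved rows cancel.
  -- The quadratic part that remains is im (Y² - X²) + 2 re XY, where re and im belong to the
  -- complex product of `u` and `t`.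
  circle-coeffs₂₂ : A → A × A → A × A → A × A → List A
  circle-coeffs₂₂ z u@(u₁ , u₂) r@(r₁ , r₂) s =
    triple u r s ∷
    ((((sq u * t₂) ⊖ ((r₁ + r₁) * cross u t)) + ((t₁ + t₁) * cross u r)) ⊖ (e * u₂)) ∷
    (- ((u₁ * t₂) + (u₂ * t₁))) ∷
    ((((t₂ + t₂) * cross u r) ⊖ ((sq u * t₁) + ((r₂ + r₂) * cross u t))) + (e * u₁)) ∷
    (((t₁ * u₁) ⊖ (t₂ * u₂)) + ((t₁ * u₁) ⊖ (t₂ * u₂))) ∷
    z ∷
    ((u₁ * t₂) + (u₂ * t₁)) ∷ []
    where
    t = s ⊟ r
    t₁ = proj₁ t
    t₂ = proj₂ t
    e = (dot r t + dot r t) + sq t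

module ℤ-Syntax = ℤSolver.+-*-Solver
module ℚ-Syntax = ℚSolver.+-*-Solver

-- Instantiating the same formulas at solver terms lets each identity be stated in the vocabulary of
-- the determinants, with nothing expanded by hand.
module ℚDet = Determinants ℚ._+_ ℚ._*_ ℚ.-_
module ℤPoly {n} = Determinants {ℤ-Syntax.Polynomial n} ℤ-Syntax._:+_ ℤ-Syntax._:*_ ℤ-Syntax.:-_
module ℚPoly {n} = Determinants {ℚ-Syntax.Polynomial n} ℚ-Syntax._:+_ ℚ-Syntax._:*_ ℚ-Syntax.:-_

open Determinants ℤ._+_ ℤ._*_ ℤ.-_ using
  ( _⊟_; _⊞_; ⊟_; dot; cross; sq; triple; det₃; det₄; curve
  ; line-coeffs; circle-coeffs₃₁; circle-coeffs₂₂)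

evaluate : List ℤ → ℤ → ℤ
evaluate = Determinants.horner ℤ._+_ ℤ._*_ ℤ.-_ 0ℤ

-- Polynomial identities behind the determinant conditions.

module _ where
  open ℤ-Syntax

  :evaluate : ∀ {n} → List (Polynomial n) → Polynomial n → Polynomial n
  :evaluate = ℤPoly.horner (con 0ℤ)

  det₃-swap₁₂ : ∀ p q r → det₃ q p r ≡ ℤ.- det₃ p q r
  det₃-swap₁₂ (p₁ , p₂) (q₁ , q₂) (r₁ , r₂) = solve 6 (λ p₁ p₂ q₁ q₂ r₁ r₂ →
    let p = p₁ , p₂ ; q = q₁ , q₂ ; r = r₁ , r₂ in
    ℤPoly.det₃ q p r := :- ℤPoly.det₃ p q r) refl p₁ p₂ q₁ q₂ r₁ r₂

  det₃-swap₂₃ : ∀ p q r → det₃ p r q ≡ ℤ.- det₃ p q r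
  det₃-swap₂₃ (p₁ , p₂) (q₁ , q₂) (r₁ , r₂) = solve 6 (λ p₁ p₂ q₁ q₂ r₁ r₂ →
    let p = p₁ , p₂ ; q = q₁ , q₂ ; r = r₁ , r₂ in
    ℤPoly.det₃ p r q := :- ℤPoly.det₃ p q r) refl p₁ p₂ q₁ q₂ r₁ r₂

  det₄-swap₁₂ : ∀ p q r s → det₄ q p r s ≡ ℤ.- det₄ p q r s
  det₄-swap₁₂ (p₁ , p₂) (q₁ , q₂) (r₁ , r₂) (s₁ , s₂) = solve 8 (λ p₁ p₂ q₁ q₂ r₁ r₂ s₁ s₂ →
    let p = p₁ , p₂ ; q = q₁ , q₂ ; r = r₁ , r₂ ; s = s₁ , s₂ in
    ℤPoly.det₄ q p r s := :- ℤPoly.det₄ p q r s) refl p₁ p₂ q₁ q₂ r₁ r₂ s₁ s₂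

  triple-swap₁₂ : ∀ u v w → triple v u w ≡ ℤ.- triple u v w
  triple-swap₁₂ (p₁ , p₂) (q₁ , q₂) (r₁ , r₂) = solve 6 (λ p₁ p₂ q₁ q₂ r₁ r₂ →
    let p = p₁ , p₂ ; q = q₁ , q₂ ; r = r₁ , r₂ in
    ℤPoly.triple q p r := :- ℤPoly.triple p q r) refl p₁ p₂ q₁ q₂ r₁ r₂

  triple-swap₂₃ : ∀ u v w → triple u w v ≡ ℤ.- triple u v w
  triple-swap₂₃ (p₁ , p₂) (q₁ , q₂) (r₁ , r₂) = solve 6 (λ p₁ p₂ q₁ q₂ r₁ r₂ →
    let p = p₁ , p₂ ; q = q₁ , q₂ ; r = r₁ , r₂ in
    ℤPoly.triple p r q := :- ℤPoly.triple p q r) refl p₁ p₂ q₁ q₂ r₁ r₂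

  ⊟-translate : ∀ p q v → (p ⊞ v) ⊟ (q ⊞ v) ≡ p ⊟ q
  ⊟-translate (p₁ , p₂) (q₁ , q₂) (v₁ , v₂) = cong₂ _,_ (f p₁ q₁ v₁) (f p₂ q₂ v₂)
    where
    f : ∀ a b c → a ℤ.+ c ℤ.- (b ℤ.+ c) ≡ a ℤ.- b
    f = solve 3 (λ a b c → (a :+ c) :- (b :+ c) := a :- b) refl

  ⊞-⊟-comm : ∀ p q v → (p ⊞ v) ⊟ q ≡ (p ⊟ q) ⊞ v
  ⊞-⊟-comm (p₁ , p₂) (q₁ , q₂) (v₁ , v₂) = cong₂ _,_ (f p₁ q₁ v₁) (f p₂ q₂ v₂)
    where
    f : ∀ a b c → a ℤ.+ c ℤ.- b ≡ a ℤ.- b ℤ.+ c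
    f = solve 3 (λ a b c → (a :+ c) :- b := (a :- b) :+ c) refl

  -- Rests on `curve` being odd.
  ⊟-curve : ∀ p q x → p ⊟ (q ⊞ curve x) ≡ (p ⊞ curve (ℤ.- x)) ⊟ q
  ⊟-curve (p₁ , p₂) (q₁ , q₂) x = cong₂ _,_
    (solve 3 (λ p q x → p :- (q :+ x) := (p :+ (:- x)) :- q)
      refl p₁ q₁ x)
    (solve 3 (λ p q x → p :- (q :+ proj₂ (ℤPoly.curve x)) :=
        (p :+ proj₂ (ℤPoly.curve (:- x))) :- q)
      refl p₂ q₂ x)

  cross-line : ∀ u r x → cross u (r ⊞ curve x) ≡ evaluate (line-coeffs 0ℤ u r) x
  cross-line (u₁ , u₂) (r₁ , r₂) = solve 5 (λ u₁ u₂ r₁ r₂ x →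
    let u = u₁ , u₂ ; r = r₁ , r₂ in
    ℤPoly.cross u (r ℤPoly.⊞ ℤPoly.curve x) := :evaluate (ℤPoly.line-coeffs (con 0ℤ) u r) x)
    refl u₁ u₂ r₁ r₂

  triple-circle₃₁ : ∀ u v r x →
    triple u v (r ⊞ curve x) ≡ evaluate (circle-coeffs₃₁ 0ℤ u v r) x
  triple-circle₃₁ (u₁ , u₂) (v₁ , v₂) (r₁ , r₂) = solve 7 (λ u₁ u₂ v₁ v₂ r₁ r₂ x →
    let u = u₁ , u₂ ; v = v₁ , v₂ ; r = r₁ , r₂ in
    ℤPoly.triple u v (r ℤPoly.⊞ ℤPoly.curve x) :=
      :evaluate (ℤPoly.circle-coeffs₃₁ (con 0ℤ) u v r) x)
    refl u₁ u₂ v₁ v₂ r₁ r₂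

  triple-circle₂₂ : ∀ u r s x →
    triple u (r ⊞ curve x) (s ⊞ curve x) ≡ evaluate (circle-coeffs₂₂ 0ℤ u r s) x
  triple-circle₂₂ (u₁ , u₂) (r₁ , r₂) (s₁ , s₂) = solve 7 (λ u₁ u₂ r₁ r₂ s₁ s₂ x →
    let u = u₁ , u₂ ; s = s₁ , s₂ ; r = r₁ , r₂ in
    ℤPoly.triple u (r ℤPoly.⊞ ℤPoly.curve x) (s ℤPoly.⊞ ℤPoly.curve x) :=
      :evaluate (ℤPoly.circle-coeffs₂₂ (con 0ℤ) u r s) x)
    refl u₁ u₂ r₁ r₂ s₁ s₂

  -- The two-square identity: the norm of a complex product is the product of the norms.
  sq-*-sq : ∀ u₁ u₂ t₁ t₂ →
    sq (u₁ , u₂) ℤ.* sq (t₁ , t₂) ≡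
    (u₁ ℤ.* t₂ ℤ.+ u₂ ℤ.* t₁) ℤ.* (u₁ ℤ.* t₂ ℤ.+ u₂ ℤ.* t₁) ℤ.+
    (t₁ ℤ.* u₁ ℤ.- t₂ ℤ.* u₂) ℤ.* (t₁ ℤ.* u₁ ℤ.- t₂ ℤ.* u₂)
  sq-*-sq = solve 4 (λ u₁ u₂ t₁ t₂ →
    ℤPoly.sq (u₁ , u₂) :* ℤPoly.sq (t₁ , t₂) :=
    ℤPoly.sq (((u₁ :* t₂) :+ (u₂ :* t₁)) ,
      ((t₁ :* u₁) :- (t₂ :* u₂))))
    refl

-- Integer polynomials at large arguments

square-abs : ∀ a → a ℤ.* a ≡ + (ℤ.∣ a ∣ ℕ.* ℤ.∣ a ∣)
square-abs (+ n)    = ℤ.+◃n≡+n _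
square-abs -[1+ n ] = ℤ.+◃n≡+n _

square≡0 : ∀ a → ℤ.∣ a ∣ ℕ.* ℤ.∣ a ∣ ≡ 0 → a ≡ 0ℤ
square≡0 (+ zero) _ = refl

sq≡0 : ∀ a b → sq (a , b) ≡ 0ℤ → a ≡ 0ℤ × b ≡ 0ℤ
sq≡0 a b eq = square≡0 a (ℕ.m+n≡0⇒m≡0 _ eq′) , square≡0 b (ℕ.m+n≡0⇒n≡0 (ℤ.∣ a ∣ ℕ.* ℤ.∣ a ∣) eq′)
  where
  eq′ = ℤ.+-injective (trans (sym (cong₂ ℤ._+_ (square-abs a) (square-abs b))) eq)

-- Bounding `∣ x ∣` covers both signs, so the notion is stable under `x ↦ - x`; the cases in which
-- most of the points move depend on that.
Eventually : (ℤ → Set) → Set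
Eventually P = ∃[ K ] ∀ x → K ℕ.≤ ℤ.∣ x ∣ → P x

always : ∀ {P : ℤ → Set} → (∀ x → P x) → Eventually P
always p = 0 , λ x _ → p x

ev-map : ∀ {P Q : ℤ → Set} → (∀ x → P x → Q x) → Eventually P → Eventually Q
ev-map f (K , h) = K , λ x K≤x → f x (h x K≤x)

ev-× : ∀ {P Q : ℤ → Set} → Eventually P → Eventually Q → Eventually (λ x → P x × Q x)
ev-× (K , f) (L , g) = K ℕ.+ L , λ x h →
  f x (ℕ.≤-trans (ℕ.m≤m+n K L) h) , g x (ℕ.≤-trans (ℕ.m≤n+m L K) h)

ev-neg : ∀ {P : ℤ → Set} → Eventually P → Eventually (λ x → P (ℤ.- x))
ev-neg (K , f) = K , λ x h → f (ℤ.- x) (subst (K ℕ.≤_) (sym (ℤ.∣-i∣≡∣i∣ x)) h)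

-- The threshold must be fixed before the hypothesis is supplied, hence the decision of `A`.
ev-→ : ∀ {A : Set} {P : ℤ → Set} → Dec A → (A → Eventually P) → Eventually (λ x → A → P x)
ev-→ (yes a) f = ev-map (λ _ p _ → p) (f a)
ev-→ (no ¬a) f = always λ _ a → contradiction a ¬a

ev-∀Fin : ∀ n {P : Fin n → ℤ → Set} →
  (∀ i → Eventually (P i)) → Eventually (λ x → ∀ i → P i x)
ev-∀Fin zero    f = always λ _ ()
ev-∀Fin (suc n) f = ev-map
  (λ { _ (p , _) zero → p ; _ (_ , q) (suc i) → q i })
  (ev-× (f zero) (ev-∀Fin n (λ i → f (suc i))))

ev-∀Vec : ∀ {n} d {P : Vec (Fin n) d → ℤ → Set} →
  (∀ v → Eventually (P v)) → Eventually (λ x → ∀ v → P v x)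
ev-∀Vec zero    f = ev-map (λ { _ p [] → p }) (f [])
ev-∀Vec (suc d) f = ev-map (λ { _ p (i ∷ v) → p i v })
  (ev-∀Fin _ λ i → ev-∀Vec d λ v → f (i ∷ v))

-- The constant coefficient is a multiple of x and smaller than ∣ x ∣.
evaluate≡0 : ∀ cs x → All (λ c → ℤ.∣ c ∣ ℕ.< ℤ.∣ x ∣) cs → evaluate cs x ≡ 0ℤ → All (_≡ 0ℤ) cs
evaluate≡0 []       x []             _  = []
evaluate≡0 (c ∷ cs) x (c<x ∷ cs<x) eq = c≡0 ∷ evaluate≡0 cs x cs<x e≡0
  where
  e = evaluate cs x
  ∣c∣≡ : ℤ.∣ c ∣ ≡ ℤ.∣ x ∣ ℕ.* ℤ.∣ e ∣
  ∣c∣≡ = trans (cong ℤ.∣_∣ (ℤ.i-j≡0⇒i≡j c (ℤ.- (x ℤ.* e))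
      (trans (cong (λ z → c ℤ.+ z) (ℤ.neg-involutive _)) eq)))
    (trans (ℤ.∣-i∣≡∣i∣ (x ℤ.* e)) (ℤ.abs-* x e))
  small : ∀ n → ℤ.∣ c ∣ ≡ ℤ.∣ x ∣ ℕ.* n → n ≡ 0
  small zero    _ = refl
  small (suc n) h = contradiction (ℕ.≤-trans (ℕ.m≤m*n ℤ.∣ x ∣ (suc n)) (ℕ.≤-reflexive (sym h))) (ℕ.<⇒≱ c<x)
  e≡0 : e ≡ 0ℤ
  e≡0 = ℤ.∣i∣≡0⇒i≡0 (small ℤ.∣ e ∣ ∣c∣≡)
  c≡0 : c ≡ 0ℤ
  c≡0 = ℤ.∣i∣≡0⇒i≡0 (trans ∣c∣≡ (trans (cong (λ e → ℤ.∣ x ∣ ℕ.* ℤ.∣ e ∣) e≡0) (ℕ.*-zeroʳ ℤ.∣ x ∣)))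

ev-bounded : ∀ cs → Eventually (λ x → All (λ c → ℤ.∣ c ∣ ℕ.< ℤ.∣ x ∣) cs)
ev-bounded []       = always λ _ → []
ev-bounded (c ∷ cs) = ev-map (λ _ (p , ps) → p ∷ ps)
  (ev-× (suc ℤ.∣ c ∣ , λ _ h → h) (ev-bounded cs))

ev-evaluate≢0 : ∀ cs → Any (_≢ 0ℤ) cs → Eventually (λ x → evaluate cs x ≢ 0ℤ)
ev-evaluate≢0 cs nz = ev-map (λ x b eq → All¬⇒¬Any (All.map (λ e ne → ne e) (evaluate≡0 cs x b eq)) nz)
  (ev-bounded cs)

-- General position of lattice points as nonvanishing determinants.

record Noncollinear (p q r : ℤ × ℤ) : Set where
  constructor noncollinear
  field det₃≢0 : det₃ p q r ≢ 0ℤ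

-- Like `Noncollinear`, a record rather than a bare inequality, so that unification recovers the
-- points in the swap lemmas.
record Nonconcyclic (p q r s : ℤ × ℤ) : Set where
  constructor nonconcyclic
  field det₄≢0 : det₄ p q r s ≢ 0ℤ

open Noncollinear public
open Nonconcyclic public

≢0-neg : ∀ {i j} → i ≡ ℤ.- j → j ≢ 0ℤ → i ≢ 0ℤ
≢0-neg eq j≢0 refl = j≢0 (ℤ.neg-injective (sym eq))

≢0-resp : ∀ {i j} → i ≡ j → j ≢ 0ℤ → i ≢ 0ℤ
≢0-resp refl h = h

swap₃¹² : ∀ {p q r} → Noncollinear p q r → Noncollinear q p r
swap₃¹² {p} {q} {r} h = noncollinear (≢0-neg (det₃-swap₁₂ p q r) (det₃≢0 h))

swap₃²³ : ∀ {p q r} → Noncollinear p q r → Noncollinear p r q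
swap₃²³ {p} {q} {r} h = noncollinear (≢0-neg (det₃-swap₂₃ p q r) (det₃≢0 h))

swap₄¹² : ∀ {p q r s} → Nonconcyclic p q r s → Nonconcyclic q p r s
swap₄¹² {p} {q} {r} {s} h = nonconcyclic (≢0-neg (det₄-swap₁₂ p q r s) (det₄≢0 h))

swap₄²³ : ∀ {p q r s} → Nonconcyclic p q r s → Nonconcyclic p r q s
swap₄²³ {p} {q} {r} {s} h = nonconcyclic (≢0-neg (triple-swap₁₂ (q ⊟ p) (r ⊟ p) (s ⊟ p)) (det₄≢0 h))

swap₄³⁴ : ∀ {p q r s} → Nonconcyclic p q r s → Nonconcyclic p q s r
swap₄³⁴ {p} {q} {r} {s} h = nonconcyclic (≢0-neg (triple-swap₂₃ (q ⊟ p) (r ⊟ p) (s ⊟ p)) (det₄≢0 h))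

triple-cong : ∀ {u u′ v v′ w w′} → u ≡ u′ → v ≡ v′ → w ≡ w′ → triple u v w ≡ triple u′ v′ w′
triple-cong refl refl refl = refl

translate₃ : ∀ p q r v → Noncollinear p q r → Noncollinear (p ⊞ v) (q ⊞ v) (r ⊞ v)
translate₃ p q r v h = noncollinear
  (≢0-resp (cong₂ cross (⊟-translate q p v) (⊟-translate r p v)) (det₃≢0 h))

translate₄ : ∀ p q r s v → Nonconcyclic p q r s → Nonconcyclic (p ⊞ v) (q ⊞ v) (r ⊞ v) (s ⊞ v)
translate₄ p q r s v h = nonconcyclic (≢0-resp
  (triple-cong (⊟-translate q p v) (⊟-translate r p v) (⊟-translate s p v)) (det₄≢0 h))

≢-split : ∀ a b c d → (a , b) ≢ (c , d) → Any (_≢ 0ℤ) ((c ℤ.- a) ∷ (d ℤ.- b) ∷ [])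
≢-split a b c d ne with a ℤ.≟ c | b ℤ.≟ d
... | no a≢c   | _        = here λ eq → a≢c (sym (ℤ.i-j≡0⇒i≡j c a eq))
... | yes _    | no b≢d   = there (here λ eq → b≢d (sym (ℤ.i-j≡0⇒i≡j d b eq)))
... | yes refl | yes refl = contradiction refl ne

ev-distinct : ∀ p q → Eventually (λ x → p ≢ q ⊞ curve x)
ev-distinct (p₁ , p₂) (q₁ , q₂) = ev-map
  (λ x ne eq → ne (trans (simplify q₁ p₁ x)
    (trans (cong (λ z → q₁ ℤ.+ x ℤ.- z) (cong proj₁ eq)) (ℤ.+-inverseʳ (q₁ ℤ.+ x)))))
  -- The first coordinates suffice: their difference is `q₁ - p₁ + x`, with leading coefficient 1.
  (ev-evaluate≢0 ((q₁ ℤ.- p₁) ∷ 1ℤ ∷ []) (there (here λ ())))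
  where
  simplify : ∀ q p x → q ℤ.- p ℤ.+ x ℤ.* (1ℤ ℤ.+ x ℤ.* 0ℤ) ≡ q ℤ.+ x ℤ.- p
  simplify = solve 3 (λ q p x → q :- p :+ x :* (con 1ℤ :+ x :* con 0ℤ) := q :+ x :- p) refl
    where open ℤ-Syntax

-- The coefficients of x³ and x are, up to sign, the coordinates of `q ⊟ p`, and one of them is
-- nonzero.
ev₂₁ : ∀ p q r → p ≢ q → Eventually (λ x → Noncollinear p q (r ⊞ curve x))
ev₂₁ p@(p₁ , p₂) q@(q₁ , q₂) r p≢q = ev-map
  (λ x → noncollinear ∘ ≢0-resp (trans (cong (cross (q ⊟ p)) (⊞-⊟-comm r p (curve x)))
    (cross-line (q ⊟ p) (r ⊟ p) x)))
  (ev-evaluate≢0 (line-coeffs 0ℤ (q ⊟ p) (r ⊟ p)) (nz (≢-split p₁ p₂ q₁ q₂ p≢q)))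
  where
  nz : Any (_≢ 0ℤ) ((q₁ ℤ.- p₁) ∷ (q₂ ℤ.- p₂) ∷ []) → Any (_≢ 0ℤ) (line-coeffs 0ℤ (q ⊟ p) (r ⊟ p))
  nz (here h)         = there (there (there (here h)))
  nz (there (here h)) = there (here (≢0-neg refl h))

-- The determinant depends on differences only, so moving two points by `curve x` amounts to moving
-- the third by `curve (- x)`.
ev₁₂ : ∀ p q r → p ≢ q → Eventually (λ x → Noncollinear (p ⊞ curve x) (q ⊞ curve x) r)
ev₁₂ p q r p≢q = ev-map
  (λ x → noncollinear ∘ ≢0-resp (cong₂ cross (⊟-translate q p (curve x)) (⊟-curve r p x)) ∘ det₃≢0)
  (ev-neg (ev₂₁ p q r p≢q))

-- The coefficient of x² is `det₃ p q r` itself; this is how the circle condition comes to depend on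
-- the line condition.
ev₃₁ : ∀ p q r s → Noncollinear p q r →
  Eventually (λ x → Nonconcyclic p q r (s ⊞ curve x))
ev₃₁ p q r s h = ev-map
  (λ x → nonconcyclic ∘ ≢0-resp (trans (cong (triple (q ⊟ p) (r ⊟ p)) (⊞-⊟-comm s p (curve x)))
    (triple-circle₃₁ (q ⊟ p) (r ⊟ p) (s ⊟ p) x)))
  (ev-evaluate≢0 (circle-coeffs₃₁ 0ℤ (q ⊟ p) (r ⊟ p) (s ⊟ p)) (there (there (here (det₃≢0 h)))))

ev₁₃ : ∀ p q r s → Noncollinear p q r →
  Eventually (λ x → Nonconcyclic (p ⊞ curve x) (q ⊞ curve x) (r ⊞ curve x) s)
ev₁₃ p q r s h = ev-map
  (λ x → nonconcyclic ∘ ≢0-resp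
    (triple-cong (⊟-translate q p (curve x)) (⊟-translate r p (curve x)) (⊟-curve s p x)) ∘ det₄≢0)
  (ev-neg (ev₃₁ p q r s h))

-- The quadratic part of the circle condition has as its coefficients the
-- real and imaginary part of the product of q - p and s - r as complex
-- numbers.
ev₂₂ : ∀ p q r s → p ≢ q → r ≢ s →
  Eventually (λ x → Nonconcyclic p q (r ⊞ curve x) (s ⊞ curve x))
ev₂₂ p@(p₁ , p₂) q@(q₁ , q₂) r@(r₁ , r₂) s@(s₁ , s₂) p≢q r≢s = ev-map
  (λ x → nonconcyclic ∘ ≢0-resp (trans
    (cong₂ (triple (q ⊟ p)) (⊞-⊟-comm r p (curve x)) (⊞-⊟-comm s p (curve x)))
    (triple-circle₂₂ (q ⊟ p) (r ⊟ p) (s ⊟ p) x)))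
  (ev-evaluate≢0 (circle-coeffs₂₂ 0ℤ (q ⊟ p) (r ⊟ p) (s ⊟ p)) nz)
  where
  u₁ = q₁ ℤ.- p₁
  u₂ = q₂ ℤ.- p₂
  t₁ = s₁ ℤ.- p₁ ℤ.- (r₁ ℤ.- p₁)
  t₂ = s₂ ℤ.- p₂ ℤ.- (r₂ ℤ.- p₂)
  re = t₁ ℤ.* u₁ ℤ.- t₂ ℤ.* u₂
  im = u₁ ℤ.* t₂ ℤ.+ u₂ ℤ.* t₁
  t≡ : ∀ a b c → a ℤ.- b ℤ.- (c ℤ.- b) ≡ a ℤ.- c
  t≡ = solve 3 (λ a b c → a :- b :- (c :- b) := a :- c) refl
    where open ℤ-Syntax
  sq≢0 : ∀ a b → Any (_≢ 0ℤ) (a ∷ b ∷ []) → sq (a , b) ≢ 0ℤ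
  sq≢0 a b (here h)         eq = h (proj₁ (sq≡0 a b eq))
  sq≢0 a b (there (here h)) eq = h (proj₂ (sq≡0 a b eq))
  double≢0 : ∀ a → a ≢ 0ℤ → a ℤ.+ a ≢ 0ℤ
  double≢0 (+ suc n)  _ ()
  double≢0 (+ zero)   h _ = h refl
  double≢0 (-[1+ n ]) _ ()
  product≢0 : sq (u₁ , u₂) ℤ.* sq (t₁ , t₂) ≢ 0ℤ
  product≢0 eq with ℤ.i*j≡0⇒i≡0∨j≡0 (sq (u₁ , u₂)) eq
  ... | inj₁ e = sq≢0 u₁ u₂ (≢-split p₁ p₂ q₁ q₂ p≢q) e
  ... | inj₂ e = sq≢0 t₁ t₂ (subst₂ (λ a b → Any (_≢ 0ℤ) (a ∷ b ∷ []))
    (sym (t≡ s₁ p₁ r₁)) (sym (t≡ s₂ p₂ r₂)) (≢-split r₁ r₂ s₁ s₂ r≢s)) e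
  nz : Any (_≢ 0ℤ) (circle-coeffs₂₂ 0ℤ (q ⊟ p) (r ⊟ p) (s ⊟ p))
  nz with im ℤ.≟ 0ℤ | re ℤ.≟ 0ℤ
  ... | no im≢0 | _        = there (there (there (there (there (there (here im≢0))))))
  ... | yes _   | no re≢0  = there (there (there (there (here (double≢0 re re≢0)))))
  ... | yes i≡0 | yes r≡0  = contradiction
    (trans (sq-*-sq u₁ u₂ t₁ t₂) (cong₂ (λ a b → a ℤ.* a ℤ.+ b ℤ.* b) i≡0 r≡0)) product≢0

⊞-cancelʳ : ∀ p q v → p ⊞ v ≡ q ⊞ v → p ≡ q
⊞-cancelʳ (p₁ , p₂) (q₁ , q₂) (v₁ , v₂) eq = cong₂ _,_
  (ℤ-+-cancelʳ v₁ p₁ q₁ (cong proj₁ eq)) (ℤ-+-cancelʳ v₂ p₂ q₂ (cong proj₂ eq))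
  where
  open import Algebra.Properties.AbelianGroup ℤ.+-0-abelianGroup
    using () renaming (∙-cancelʳ to ℤ-+-cancelʳ)

-- Generic projections of the cube

Cube : ℕ → Set
Cube = Vec (Fin 2)

infix 4 _≟ᶜ_
_≟ᶜ_ : ∀ {d} (x y : Cube d) → Dec (x ≡ y)
_≟ᶜ_ = Vec.≡-dec Fin._≟_

-- The three conditions form one induction hypothesis: distinctness feeds the line condition of the
-- next cube, and distinctness and the line condition feed its circle condition.
record Generic {d} (P : Cube d → ℤ × ℤ) : Set where
  field
    injective     : ∀ x y → x ≢ y → P x ≢ P y
    not-on-line   : ∀ x y z → x ≢ y → x ≢ z → y ≢ z → Noncollinear (P x) (P y) (P z)
    not-on-circle : ∀ x y z w → x ≢ y → x ≢ z → y ≢ z → x ≢ w → y ≢ w → z ≢ w →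
      Nonconcyclic (P x) (P y) (P z) (P w)

extend : ∀ {d} → (Cube d → ℤ × ℤ) → ℤ × ℤ → Cube (suc d) → ℤ × ℤ
extend P v (0F ∷ x) = P x
extend P v (1F ∷ x) = P x ⊞ v

module _ {d} {P : Cube d → ℤ × ℤ} (generic : Generic P) where
  open Generic generic

  P⁺ : ℤ → Cube (suc d) → ℤ × ℤ
  P⁺ k = extend P (curve k)

  -- Available only for vertices with the same first coordinate; vertices from different halves may
  -- have equal tails, so the lemmas on moved points assume distinctness within each half only.
  tail≢ : ∀ {b} {x y : Cube d} → (b ∷ x) ≢ (b ∷ y) → x ≢ y
  tail≢ ne refl = ne refl

  ev-injective : ∀ x y → x ≢ y → Eventually (λ k → P⁺ k x ≢ P⁺ k y)
  ev-injective (0F ∷ x) (0F ∷ y) ne = always λ _ → injective x y (tail≢ ne)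
  ev-injective (0F ∷ x) (1F ∷ y) ne = ev-distinct (P x) (P y)
  ev-injective (1F ∷ x) (0F ∷ y) ne = ev-map (λ _ h → h ∘ sym) (ev-distinct (P y) (P x))
  ev-injective (1F ∷ x) (1F ∷ y) ne = always λ k eq →
    injective x y (tail≢ ne) (⊞-cancelʳ (P x) (P y) (curve k) eq)

  ev-noncollinear : ∀ x y z → x ≢ y → x ≢ z → y ≢ z →
    Eventually (λ k → Noncollinear (P⁺ k x) (P⁺ k y) (P⁺ k z))
  ev-noncollinear (0F ∷ x) (0F ∷ y) (0F ∷ z) xy xz yz =
    always λ k → not-on-line x y z (tail≢ xy) (tail≢ xz) (tail≢ yz)
  ev-noncollinear (0F ∷ x) (0F ∷ y) (1F ∷ z) xy xz yz =
    ev₂₁ (P x) (P y) (P z) (injective x y (tail≢ xy))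
  ev-noncollinear (0F ∷ x) (1F ∷ y) (0F ∷ z) xy xz yz =
    ev-map (λ _ → swap₃²³) (ev₂₁ (P x) (P z) (P y) (injective x z (tail≢ xz)))
  ev-noncollinear (1F ∷ x) (0F ∷ y) (0F ∷ z) xy xz yz =
    ev-map (λ _ → swap₃¹² ∘ swap₃²³) (ev₂₁ (P y) (P z) (P x) (injective y z (tail≢ yz)))
  ev-noncollinear (1F ∷ x) (1F ∷ y) (0F ∷ z) xy xz yz =
    ev₁₂ (P x) (P y) (P z) (injective x y (tail≢ xy))
  ev-noncollinear (1F ∷ x) (0F ∷ y) (1F ∷ z) xy xz yz =
    ev-map (λ _ → swap₃²³) (ev₁₂ (P x) (P z) (P y) (injective x z (tail≢ xz)))
  ev-noncollinear (0F ∷ x) (1F ∷ y) (1F ∷ z) xy xz yz =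
    ev-map (λ _ → swap₃¹² ∘ swap₃²³) (ev₁₂ (P y) (P z) (P x) (injective y z (tail≢ yz)))
  ev-noncollinear (1F ∷ x) (1F ∷ y) (1F ∷ z) xy xz yz =
    always λ k → translate₃ (P x) (P y) (P z) (curve k)
      (not-on-line x y z (tail≢ xy) (tail≢ xz) (tail≢ yz))

  ev-cube₃₁ : ∀ x y z w → x ≢ y → x ≢ z → y ≢ z →
    Eventually (λ k → Nonconcyclic (P x) (P y) (P z) (P w ⊞ curve k))
  ev-cube₃₁ x y z w xy xz yz = ev₃₁ (P x) (P y) (P z) (P w) (not-on-line x y z xy xz yz)

  ev-cube₁₃ : ∀ x y z w → x ≢ y → x ≢ z → y ≢ z →
    Eventually (λ k → Nonconcyclic (P x ⊞ curve k) (P y ⊞ curve k) (P z ⊞ curve k) (P w))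
  ev-cube₁₃ x y z w xy xz yz = ev₁₃ (P x) (P y) (P z) (P w) (not-on-line x y z xy xz yz)

  ev-cube₂₂ : ∀ x y z w → x ≢ y → z ≢ w →
    Eventually (λ k → Nonconcyclic (P x) (P y) (P z ⊞ curve k) (P w ⊞ curve k))
  ev-cube₂₂ x y z w xy zw = ev₂₂ (P x) (P y) (P z) (P w) (injective x y xy) (injective z w zw)

  -- The first coordinates decide the argument. Splits 4-0 and 0-4 repeat or translate an old
  -- quadruple, 3-1 and 1-3 use noncollinearity of the three, and 2-2 uses distinctness of the two
  -- pairs; the swaps bring every order to one of these.
  ev-nonconcyclic : ∀ x y z w → x ≢ y → x ≢ z → y ≢ z → x ≢ w → y ≢ w → z ≢ w →
    Eventually (λ k → Nonconcyclic (P⁺ k x) (P⁺ k y) (P⁺ k z) (P⁺ k w))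
  ev-nonconcyclic (0F ∷ x) (0F ∷ y) (0F ∷ z) (0F ∷ w) xy xz yz xw yw zw =
    always λ k → not-on-circle x y z w (tail≢ xy) (tail≢ xz) (tail≢ yz) (tail≢ xw) (tail≢ yw) (tail≢ zw)
  ev-nonconcyclic (0F ∷ x) (0F ∷ y) (0F ∷ z) (1F ∷ w) xy xz yz xw yw zw =
    ev-cube₃₁ x y z w (tail≢ xy) (tail≢ xz) (tail≢ yz)
  ev-nonconcyclic (0F ∷ x) (0F ∷ y) (1F ∷ z) (0F ∷ w) xy xz yz xw yw zw =
    ev-map (λ _ → swap₄³⁴) (ev-cube₃₁ x y w z (tail≢ xy) (tail≢ xw) (tail≢ yw))
  ev-nonconcyclic (0F ∷ x) (1F ∷ y) (0F ∷ z) (0F ∷ w) xy xz yz xw yw zw =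
    ev-map (λ _ → swap₄²³ ∘ swap₄³⁴) (ev-cube₃₁ x z w y (tail≢ xz) (tail≢ xw) (tail≢ zw))
  ev-nonconcyclic (1F ∷ x) (0F ∷ y) (0F ∷ z) (0F ∷ w) xy xz yz xw yw zw =
    ev-map (λ _ → swap₄¹² ∘ swap₄²³ ∘ swap₄³⁴) (ev-cube₃₁ y z w x (tail≢ yz) (tail≢ yw) (tail≢ zw))
  ev-nonconcyclic (0F ∷ x) (0F ∷ y) (1F ∷ z) (1F ∷ w) xy xz yz xw yw zw =
    ev-cube₂₂ x y z w (tail≢ xy) (tail≢ zw)
  ev-nonconcyclic (0F ∷ x) (1F ∷ y) (0F ∷ z) (1F ∷ w) xy xz yz xw yw zw =
    ev-map (λ _ → swap₄²³) (ev-cube₂₂ x z y w (tail≢ xz) (tail≢ yw))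
  ev-nonconcyclic (0F ∷ x) (1F ∷ y) (1F ∷ z) (0F ∷ w) xy xz yz xw yw zw =
    ev-map (λ _ → swap₄³⁴ ∘ swap₄²³) (ev-cube₂₂ x w y z (tail≢ xw) (tail≢ yz))
  ev-nonconcyclic (1F ∷ x) (0F ∷ y) (0F ∷ z) (1F ∷ w) xy xz yz xw yw zw =
    ev-map (λ _ → swap₄¹² ∘ swap₄²³) (ev-cube₂₂ y z x w (tail≢ yz) (tail≢ xw))
  ev-nonconcyclic (1F ∷ x) (0F ∷ y) (1F ∷ z) (0F ∷ w) xy xz yz xw yw zw =
    ev-map (λ _ → swap₄³⁴ ∘ swap₄¹² ∘ swap₄²³) (ev-cube₂₂ y w x z (tail≢ yw) (tail≢ xz))
  ev-nonconcyclic (1F ∷ x) (1F ∷ y) (0F ∷ z) (0F ∷ w) xy xz yz xw yw zw =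
    ev-map (λ _ → swap₄²³ ∘ swap₄³⁴ ∘ swap₄¹² ∘ swap₄²³) (ev-cube₂₂ z w x y (tail≢ zw) (tail≢ xy))
  ev-nonconcyclic (1F ∷ x) (1F ∷ y) (1F ∷ z) (0F ∷ w) xy xz yz xw yw zw =
    ev-cube₁₃ x y z w (tail≢ xy) (tail≢ xz) (tail≢ yz)
  ev-nonconcyclic (1F ∷ x) (1F ∷ y) (0F ∷ z) (1F ∷ w) xy xz yz xw yw zw =
    ev-map (λ _ → swap₄³⁴) (ev-cube₁₃ x y w z (tail≢ xy) (tail≢ xw) (tail≢ yw))
  ev-nonconcyclic (1F ∷ x) (0F ∷ y) (1F ∷ z) (1F ∷ w) xy xz yz xw yw zw =
    ev-map (λ _ → swap₄²³ ∘ swap₄³⁴) (ev-cube₁₃ x z w y (tail≢ xz) (tail≢ xw) (tail≢ zw))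
  ev-nonconcyclic (0F ∷ x) (1F ∷ y) (1F ∷ z) (1F ∷ w) xy xz yz xw yw zw =
    ev-map (λ _ → swap₄¹² ∘ swap₄²³ ∘ swap₄³⁴) (ev-cube₁₃ y z w x (tail≢ yz) (tail≢ yw) (tail≢ zw))
  ev-nonconcyclic (1F ∷ x) (1F ∷ y) (1F ∷ z) (1F ∷ w) xy xz yz xw yw zw =
    always λ k → translate₄ (P x) (P y) (P z) (P w) (curve k)
      (not-on-circle x y z w (tail≢ xy) (tail≢ xz) (tail≢ yz) (tail≢ xw) (tail≢ yw) (tail≢ zw))

  ev-≢→ : ∀ {e} {x y : Cube e} {Q : ℤ → Set} →
    (x ≢ y → Eventually Q) → Eventually (λ k → x ≢ y → Q k)
  ev-≢→ = ev-→ (¬? (_ ≟ᶜ _))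

  ev-generic : Eventually (λ k → Generic (P⁺ k))
  ev-generic = ev-map
    (λ _ (f , g , h) → record { injective = f ; not-on-line = g ; not-on-circle = h })
    (ev-×
      (ev-∀Vec _ λ x → ev-∀Vec _ λ y → ev-≢→ λ xy → ev-injective x y xy)
      (ev-×
        (ev-∀Vec _ λ x → ev-∀Vec _ λ y → ev-∀Vec _ λ z →
          ev-≢→ λ xy → ev-≢→ λ xz → ev-≢→ λ yz → ev-noncollinear x y z xy xz yz)
        (ev-∀Vec _ λ x → ev-∀Vec _ λ y → ev-∀Vec _ λ z → ev-∀Vec _ λ w →
          ev-≢→ λ xy → ev-≢→ λ xz → ev-≢→ λ yz → ev-≢→ λ xw → ev-≢→ λ yw → ev-≢→ λ zw →
            ev-nonconcyclic x y z w xy xz yz xw yw zw)))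

cube : ∀ {d} → Vec (ℤ × ℤ) d → Cube d → ℤ × ℤ
cube []       [] = 0ℤ , 0ℤ
cube (v ∷ vs)    = extend (cube vs) v

generic-cube : ∀ d → ∃[ vs ] Generic (cube {d} vs)
generic-cube zero    = [] , record
  { injective    = λ { [] [] ne → contradiction refl ne }
  ; not-on-line = λ { [] [] _ ne → contradiction refl ne }
  ; not-on-circle = λ { [] [] _ _ ne → contradiction refl ne }
  }
generic-cube (suc d) =
  let vs , generic = generic-cube d
      K , h        = ev-generic generic
  in curve (+ K) ∷ vs , h (+ K) ℕ.≤-refl

-- Rational and real numbers

-- Chosen so that `fromℕ n` is `fromℚ (ι (+ n))` by definition.
ι : ℤ → ℚ
ι i = i ℚ./ 1

toℚᵘ-ι : ∀ i → ℚ.toℚᵘ (ι i) ℚᵘ.≃ ℚᵘ.mkℚᵘ i 0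
toℚᵘ-ι i = ℚ.toℚᵘ-fromℚᵘ (ℚᵘ.mkℚᵘ i 0)

-- Normalisation by a gcd blocks computation on variables, so the laws of `ι` are proved for
-- unnormalised rationals and carried back.
ι-+ : ∀ i j → ι (i ℤ.+ j) ≡ ι i ℚ.+ ι j
ι-+ i j = ℚ.toℚᵘ-injective (begin
  ℚ.toℚᵘ (ι (i ℤ.+ j))                   ≈⟨ toℚᵘ-ι (i ℤ.+ j) ⟩
  ℚᵘ.mkℚᵘ (i ℤ.+ j) 0                    ≈⟨ ℚᵘ.*≡* (cong₂ (λ a b → (a ℤ.+ b) ℤ.* 1ℤ)
                                              (sym (ℤ.*-identityʳ i)) (sym (ℤ.*-identityʳ j))) ⟩
  ℚᵘ.mkℚᵘ i 0 ℚᵘ.+ ℚᵘ.mkℚᵘ j 0           ≈⟨ ℚᵘ.+-cong (toℚᵘ-ι i) (toℚᵘ-ι j) ⟨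
  ℚ.toℚᵘ (ι i) ℚᵘ.+ ℚ.toℚᵘ (ι j)         ≈⟨ ℚ.toℚᵘ-homo-+ (ι i) (ι j) ⟨
  ℚ.toℚᵘ (ι i ℚ.+ ι j)                   ∎)
  where open ℚᵘ.≃-Reasoning

ι-* : ∀ i j → ι (i ℤ.* j) ≡ ι i ℚ.* ι j
ι-* i j = ℚ.toℚᵘ-injective (begin
  ℚ.toℚᵘ (ι (i ℤ.* j))                   ≈⟨ toℚᵘ-ι (i ℤ.* j) ⟩
  ℚᵘ.mkℚᵘ i 0 ℚᵘ.* ℚᵘ.mkℚᵘ j 0           ≈⟨ ℚᵘ.*-cong (toℚᵘ-ι i) (toℚᵘ-ι j) ⟨
  ℚ.toℚᵘ (ι i) ℚᵘ.* ℚ.toℚᵘ (ι j)         ≈⟨ ℚ.toℚᵘ-homo-* (ι i) (ι j) ⟨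
  ℚ.toℚᵘ (ι i ℚ.* ι j)                   ∎)
  where open ℚᵘ.≃-Reasoning

ι-neg : ∀ i → ι (ℤ.- i) ≡ ℚ.- ι i
ι-neg i = ℚ.toℚᵘ-injective (begin
  ℚ.toℚᵘ (ι (ℤ.- i))     ≈⟨ toℚᵘ-ι (ℤ.- i) ⟩
  ℚᵘ.- ℚᵘ.mkℚᵘ i 0       ≈⟨ ℚᵘ.-‿cong (toℚᵘ-ι i) ⟨
  ℚᵘ.- ℚ.toℚᵘ (ι i)      ≈⟨ ℚ.toℚᵘ-homo‿- (ι i) ⟨
  ℚ.toℚᵘ (ℚ.- ι i)       ∎)
  where open ℚᵘ.≃-Reasoning

ι-mono-≤ : ∀ {i j} → i ℤ.≤ j → ι i ℚ.≤ ι j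
ι-mono-≤ {i} {j} i≤j = ℚ.toℚᵘ-cancel-≤ (begin
  ℚ.toℚᵘ (ι i)   ≃⟨ toℚᵘ-ι i ⟩
  ℚᵘ.mkℚᵘ i 0    ≤⟨ ℚᵘ.*≤* (ℤ.*-monoʳ-≤-nonNeg 1ℤ i≤j) ⟩
  ℚᵘ.mkℚᵘ j 0    ≃⟨ toℚᵘ-ι j ⟨
  ℚ.toℚᵘ (ι j)   ∎)
  where open ℚᵘ.≤-Reasoning

ι-injective : ∀ {i j} → ι i ≡ ι j → i ≡ j
ι-injective {i} {j} eq = ℤ.*-cancelʳ-≡ i j 1ℤ
  (ℚᵘ.drop-*≡* (ℚᵘ.≃-trans (ℚᵘ.≃-sym (toℚᵘ-ι i)) (ℚᵘ.≃-trans (ℚ.toℚᵘ-cong eq) (toℚᵘ-ι j))))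

ι₂ : ℤ × ℤ → ℚ × ℚ
ι₂ (a , b) = ι a , ι b

ι-- : ∀ i j → ι (i ℤ.- j) ≡ ι i ℚ.- ι j
ι-- i j = trans (ι-+ i (ℤ.- j)) (cong (λ x → ι i ℚ.+ x) (ι-neg j))

ι-⊟ : ∀ p q → ι₂ (p ⊟ q) ≡ ι₂ p ℚDet.⊟ ι₂ q
ι-⊟ (p₁ , p₂) (q₁ , q₂) = cong₂ _,_ (ι-- p₁ q₁) (ι-- p₂ q₂)

ι-dot : ∀ u v → ι (dot u v) ≡ ℚDet.dot (ι₂ u) (ι₂ v)
ι-dot (a , b) (c , d) = trans (ι-+ (a ℤ.* c) (b ℤ.* d)) (cong₂ ℚ._+_ (ι-* a c) (ι-* b d))

ι-cross : ∀ u v → ι (cross u v) ≡ ℚDet.cross (ι₂ u) (ι₂ v)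
ι-cross (a , b) (c , d) = trans (ι-- (a ℤ.* d) (b ℤ.* c)) (cong₂ ℚ._-_ (ι-* a d) (ι-* b c))

ι-triple : ∀ u v w → ι (triple u v w) ≡ ℚDet.triple (ι₂ u) (ι₂ v) (ι₂ w)
ι-triple u v w = trans (ι-+ (sq u ℤ.* cross v w ℤ.- sq v ℤ.* cross u w) (sq w ℤ.* cross u v))
  (cong₂ ℚ._+_
    (trans (ι-- (sq u ℤ.* cross v w) (sq v ℤ.* cross u w)) (cong₂ ℚ._-_ (minor u v w) (minor v u w)))
    (minor w u v))
  where
  minor : ∀ u v w → ι (sq u ℤ.* cross v w) ≡ ℚDet.sq (ι₂ u) ℚ.* ℚDet.cross (ι₂ v) (ι₂ w)
  minor u v w = trans (ι-* (sq u) (cross v w)) (cong₂ ℚ._*_ (ι-dot u u) (ι-cross v w))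

ι-det₃ : ∀ p q r → ι (det₃ p q r) ≡ ℚDet.det₃ (ι₂ p) (ι₂ q) (ι₂ r)
ι-det₃ p q r = trans (ι-cross (q ⊟ p) (r ⊟ p)) (cong₂ ℚDet.cross (ι-⊟ q p) (ι-⊟ r p))

ι-det₄ : ∀ p q r s → ι (det₄ p q r s) ≡ ℚDet.det₄ (ι₂ p) (ι₂ q) (ι₂ r) (ι₂ s)
ι-det₄ p q r s = trans (ι-triple (q ⊟ p) (r ⊟ p) (s ⊟ p))
  (eq (ι-⊟ q p) (ι-⊟ r p) (ι-⊟ s p))
  where
  eq : ∀ {u u′ v v′ w w′} → u ≡ u′ → v ≡ v′ → w ≡ w′ → ℚDet.triple u v w ≡ ℚDet.triple u′ v′ w′
  eq refl refl refl = refl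

-- Null sequences

-- `x ≈ y` unfolds to `Null (λ n → seq x n - seq y n)`, so real equations serve directly as
-- hypotheses about null sequences.
Null : (ℕ → ℚ) → Set
Null f = ∀ ε → 0ℚ ℚ.< ε → ∃[ N ] ∀ n → N ℕ.≤ n → ℚ.∣ f n ∣ ℚ.≤ ε

halve : ∀ {ε} → 0ℚ ℚ.< ε → 0ℚ ℚ.< ε ℚ.* ½
halve {ε} 0<ε = subst (ℚ._< ε ℚ.* ½) (ℚ.*-zeroˡ ½) (ℚ.*-monoˡ-<-pos ½ 0<ε)

two-halves : ∀ ε → ε ℚ.* ½ ℚ.+ ε ℚ.* ½ ≡ ε
two-halves ε = trans (sym (ℚ.*-distribˡ-+ ε ½ ½)) (ℚ.*-identityʳ ε)

half-< : ∀ {ε} → 0ℚ ℚ.< ε → ε ℚ.* ½ ℚ.< ε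
half-< {ε} 0<ε = subst₂ ℚ._<_ (ℚ.+-identityʳ (ε ℚ.* ½)) (two-halves ε)
  (ℚ.+-monoʳ-< (ε ℚ.* ½) (halve 0<ε))

0<1ℚ : 0ℚ ℚ.< 1ℚ
0<1ℚ = ℚ.positive⁻¹ 1ℚ

*-pos : ∀ {p q} → 0ℚ ℚ.< p → 0ℚ ℚ.< q → 0ℚ ℚ.< p ℚ.* q
*-pos {p} {q} 0<p 0<q = subst (ℚ._< p ℚ.* q) (ℚ.*-zeroʳ p) (ℚ.*-monoʳ-<-pos p {{ℚ.positive 0<p}} 0<q)

reciprocal : ∀ s → 0ℚ ℚ.< s → ∃[ r ] 0ℚ ℚ.< r × s ℚ.* r ≡ 1ℚ
reciprocal s 0<s = (ℚ.1/ s) , ℚ.positive⁻¹ (ℚ.1/ s) {{ℚ.1/pos⇒pos s}} , ℚ.*-inverseʳ s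
  where
  instance
    s⁺ : ℚ.Positive s
    s⁺ = ℚ.positive 0<s
    s≢0 : ℚ.NonZero s
    s≢0 = ℚ.pos⇒nonZero s

null-cong : ∀ {f g} → (∀ n → f n ≡ g n) → Null f → Null g
null-cong eq h ε 0<ε with h ε 0<ε
... | N , b = N , λ n n≥ → subst (λ x → ℚ.∣ x ∣ ℚ.≤ ε) (eq n) (b n n≥)

null-+ : ∀ {f g} → Null f → Null g → Null (λ n → f n ℚ.+ g n)
null-+ {f} {g} hf hg ε 0<ε with hf (ε ℚ.* ½) (halve 0<ε) | hg (ε ℚ.* ½) (halve 0<ε)
... | M , bf | N , bg = M ℕ.+ N , λ n n≥ → ℚ.≤-trans (ℚ.∣p+q∣≤∣p∣+∣q∣ (f n) (g n))
  (subst (ℚ.∣ f n ∣ ℚ.+ ℚ.∣ g n ∣ ℚ.≤_) (two-halves ε)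
    (ℚ.+-mono-≤ (bf n (ℕ.≤-trans (ℕ.m≤m+n M N) n≥)) (bg n (ℕ.≤-trans (ℕ.m≤n+m N M) n≥))))

null-neg : ∀ {f} → Null f → Null (λ n → ℚ.- f n)
null-neg {f} h ε 0<ε with h ε 0<ε
... | N , b = N , λ n n≥ → subst (ℚ._≤ ε) (sym (ℚ.∣-p∣≡∣p∣ (f n))) (b n n≥)

null-- : ∀ {f g} → Null f → Null g → Null (λ n → f n ℚ.- g n)
null-- hf hg = null-+ hf (null-neg hg)

bounded : ∀ (x : ℝ) → ∃[ B ] 0ℚ ℚ.< B × ∃[ N ] ∀ n → N ℕ.≤ n → ℚ.∣ seq x n ∣ ℚ.≤ B
bounded x with cauchy x 1ℚ 0<1ℚ
... | N , h = 1ℚ ℚ.+ ℚ.∣ seq x N ∣ , ℚ.+-mono-<-≤ 0<1ℚ (ℚ.0≤∣p∣ (seq x N)) , N , λ n n≥ →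
  ℚ.≤-trans
    (subst (λ y → ℚ.∣ y ∣ ℚ.≤ ℚ.∣ seq x n ℚ.- seq x N ∣ ℚ.+ ℚ.∣ seq x N ∣)
      (solve 2 (λ a b → a :- b :+ b := a) refl (seq x n) (seq x N))
      (ℚ.∣p+q∣≤∣p∣+∣q∣ (seq x n ℚ.- seq x N) (seq x N)))
    (ℚ.+-monoˡ-≤ ℚ.∣ seq x N ∣ (h n N n≥ ℕ.≤-refl))
  where open ℚ-Syntax

*-mono-∣∣ : ∀ p q {a b} → ℚ.∣ p ∣ ℚ.≤ a → 0ℚ ℚ.< a → ℚ.∣ q ∣ ℚ.≤ b → ℚ.∣ p ℚ.* q ∣ ℚ.≤ a ℚ.* b
*-mono-∣∣ p q {a} {b} p≤a 0<a q≤b = begin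
  ℚ.∣ p ℚ.* q ∣         ≡⟨ ℚ.∣p*q∣≡∣p∣*∣q∣ p q ⟩
  ℚ.∣ p ∣ ℚ.* ℚ.∣ q ∣   ≤⟨ ℚ.*-monoʳ-≤-nonNeg ℚ.∣ q ∣ {{ℚ.nonNegative (ℚ.0≤∣p∣ q)}} p≤a ⟩
  a ℚ.* ℚ.∣ q ∣         ≤⟨ ℚ.*-monoˡ-≤-nonNeg a {{ℚ.nonNegative (ℚ.<⇒≤ 0<a)}} q≤b ⟩
  a ℚ.* b               ∎
  where open ℚ.≤-Reasoning

divide : ∀ s → 0ℚ ℚ.< s → ∀ ε → 0ℚ ℚ.< ε → ∃[ δ ] 0ℚ ℚ.< δ × s ℚ.* δ ≡ ε
divide s 0<s ε 0<ε =
  let r , 0<r , sr≡1 = reciprocal s 0<s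
  in r ℚ.* ε , *-pos {r} {ε} 0<r 0<ε ,
     trans (sym (ℚ.*-assoc s r ε)) (trans (cong (λ x → x ℚ.* ε) sr≡1) (ℚ.*-identityˡ ε))

null-* : ∀ (x : ℝ) {f} → Null f → Null (λ n → seq x n ℚ.* f n)
null-* x {f} h ε 0<ε =
  let B , 0<B , M , x≤B = bounded x
      δ , 0<δ , Bδ≡ε    = divide B 0<B ε 0<ε
      N , f≤δ           = h δ 0<δ
  in M ℕ.+ N , λ n n≥ → subst (λ e → ℚ.∣ seq x n ℚ.* f n ∣ ℚ.≤ e) Bδ≡ε
    (*-mono-∣∣ (seq x n) (f n) {B} {δ} (x≤B n (ℕ.≤-trans (ℕ.m≤m+n M N) n≥)) 0<B
      (f≤δ n (ℕ.≤-trans (ℕ.m≤n+m N M) n≥)))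

null-const : ∀ c → Null (λ _ → c) → c ≡ 0ℚ
null-const c h = ℚ.∣p∣≡0⇒p≡0 c (ℚ.≤-antisym (ℚ.≮⇒≥ 0≮∣c∣) (ℚ.0≤∣p∣ c))
  where
  0≮∣c∣ : ¬ 0ℚ ℚ.< ℚ.∣ c ∣
  0≮∣c∣ 0<∣c∣ =
    let N , small = h (ℚ.∣ c ∣ ℚ.* ½) (halve 0<∣c∣)
    in ℚ.<-irrefl refl (ℚ.≤-<-trans (small N ℕ.≤-refl) (half-< 0<∣c∣))

null-cancel : ∀ d {f} → d ≢ 0ℚ → Null (λ n → d ℚ.* f n) → Null f
null-cancel d {f} d≢0 h = null-cong
  (λ n → trans (sym (ℚ.*-assoc (ℚ.1/ d) d (f n)))
    (trans (cong (ℚ._* f n) (ℚ.*-inverseˡ d)) (ℚ.*-identityˡ (f n))))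
  (null-* (fromℚ (ℚ.1/ d)) h)
  where instance _ = ℚ.≢-nonZero d≢0

-- Lines, circles and angles through lattice points

⟦_⟧ : ℤ × ℤ → Point
⟦ a , b ⟧ = fromℚ (ι a) , fromℚ (ι b)

ι≢0 : ∀ {i} → i ≢ 0ℤ → ι i ≢ 0ℚ
ι≢0 i≢0 eq = i≢0 (ι-injective eq)

⟦⟧-injective : ∀ p q → ⟦ p ⟧ ≈ₚ ⟦ q ⟧ → p ≡ q
⟦⟧-injective (p₁ , p₂) (q₁ , q₂) (h₁ , h₂) = cong₂ _,_ (f p₁ q₁ h₁) (f p₂ q₂ h₂)
  where
  f : ∀ i j → fromℚ (ι i) ≈ fromℚ (ι j) → i ≡ j
  f i j h = ℤ.i-j≡0⇒i≡j i j (ι-injective (trans (ι-- i j) (null-const (ι i ℚ.- ι j) h)))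

-- `OnLine`, and the equation in `OnCircle`, unfold to the statement that `line-form`, respectively
-- `circle-form`, is null along the sequences of the real parameters. This reduces real algebra to
-- rational identities for each index.
line-form : ℚ → ℚ → ℚ → ℚ × ℚ → ℚ
line-form a b c (x , y) = a ℚ.* x ℚ.+ b ℚ.* y ℚ.- c

circle-form : ℚ → ℚ × ℚ → ℚ × ℚ → ℚ
circle-form ρ o p = ρ ℚ.* ρ ℚ.- ℚDet.sq (p ℚDet.⊟ o)

:line-form : ∀ {n} → let A = ℚ-Syntax.Polynomial n in (a b c : A) → A × A → A
:line-form a b c (x , y) = a :* x :+ b :* y :- c
  where open ℚ-Syntax

:circle-form : ∀ {n} → let A = ℚ-Syntax.Polynomial n in A → (o p : A × A) → A
:circle-form ρ o p = ρ :* ρ :- ℚPoly.sq (p ℚPoly.⊟ o)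
  where open ℚ-Syntax

line-cramer₁ : ∀ a b c p₁ p₂ q₁ q₂ r₁ r₂ →
  (r₂ ℚ.- p₂) ℚ.* (line-form a b c (q₁ , q₂) ℚ.- line-form a b c (p₁ , p₂)) ℚ.-
  (q₂ ℚ.- p₂) ℚ.* (line-form a b c (r₁ , r₂) ℚ.- line-form a b c (p₁ , p₂)) ≡
  ℚDet.det₃ (p₁ , p₂) (q₁ , q₂) (r₁ , r₂) ℚ.* a
line-cramer₁ = solve 9 (λ a b c p₁ p₂ q₁ q₂ r₁ r₂ →
  (r₂ :- p₂) :* (:line-form a b c (q₁ , q₂) :- :line-form a b c (p₁ , p₂)) :-
  (q₂ :- p₂) :* (:line-form a b c (r₁ , r₂) :- :line-form a b c (p₁ , p₂)) :=
  ℚPoly.det₃ (p₁ , p₂) (q₁ , q₂) (r₁ , r₂) :* a) refl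
  where open ℚ-Syntax

line-cramer₂ : ∀ a b c p₁ p₂ q₁ q₂ r₁ r₂ →
  (q₁ ℚ.- p₁) ℚ.* (line-form a b c (r₁ , r₂) ℚ.- line-form a b c (p₁ , p₂)) ℚ.-
  (r₁ ℚ.- p₁) ℚ.* (line-form a b c (q₁ , q₂) ℚ.- line-form a b c (p₁ , p₂)) ≡
  ℚDet.det₃ (p₁ , p₂) (q₁ , q₂) (r₁ , r₂) ℚ.* b
line-cramer₂ = solve 9 (λ a b c p₁ p₂ q₁ q₂ r₁ r₂ →
  (q₁ :- p₁) :* (:line-form a b c (r₁ , r₂) :- :line-form a b c (p₁ , p₂)) :-
  (r₁ :- p₁) :* (:line-form a b c (q₁ , q₂) :- :line-form a b c (p₁ , p₂)) :=
  ℚPoly.det₃ (p₁ , p₂) (q₁ , q₂) (r₁ , r₂) :* b) refl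
  where open ℚ-Syntax

-- The difference of the forms at `p` and `q` is |q - p|² plus a linear form in q - p, the same
-- linear form for `q`, `r` and `s`. Putting these differences in the first column of `det₄` adds a
-- combination of the other two columns, so the value is unchanged.
circle-expand : ∀ ρ o₁ o₂ p₁ p₂ q₁ q₂ r₁ r₂ s₁ s₂ →
  let o = o₁ , o₂ ; p = p₁ , p₂ ; q = q₁ , q₂ ; r = r₁ , r₂ ; s = s₁ , s₂ in
  ℚDet.cross (r ℚDet.⊟ p) (s ℚDet.⊟ p) ℚ.* (circle-form ρ o p ℚ.- circle-form ρ o q) ℚ.-
  ℚDet.cross (q ℚDet.⊟ p) (s ℚDet.⊟ p) ℚ.* (circle-form ρ o p ℚ.- circle-form ρ o r) ℚ.+
  ℚDet.cross (q ℚDet.⊟ p) (r ℚDet.⊟ p) ℚ.* (circle-form ρ o p ℚ.- circle-form ρ o s) ≡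
  ℚDet.det₄ p q r s
circle-expand = solve 11 (λ ρ o₁ o₂ p₁ p₂ q₁ q₂ r₁ r₂ s₁ s₂ →
  let o = o₁ , o₂ ; p = p₁ , p₂ ; q = q₁ , q₂ ; r = r₁ , r₂ ; s = s₁ , s₂ in
  ℚPoly.cross (r ℚPoly.⊟ p) (s ℚPoly.⊟ p) :* (:circle-form ρ o p :- :circle-form ρ o q) :-
  ℚPoly.cross (q ℚPoly.⊟ p) (s ℚPoly.⊟ p) :* (:circle-form ρ o p :- :circle-form ρ o r) :+
  ℚPoly.cross (q ℚPoly.⊟ p) (r ℚPoly.⊟ p) :* (:circle-form ρ o p :- :circle-form ρ o s) :=
  ℚPoly.det₄ p q r s) refl
  where open ℚ-Syntax

minus-0 : ∀ x → x ℚ.- 0ℚ ≡ x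
minus-0 = solve 1 (λ x → x :- con 0ℚ := x) refl
  where open ℚ-Syntax

-- On a line a x + b y = c through p, q, r, Cramer's rule expresses a and b
-- times det₃ p q r through the differences of the three equations.
not-collinear : ∀ p q r → Noncollinear p q r → ¬ Collinear ⟦ p ⟧ ⟦ q ⟧ ⟦ r ⟧
not-collinear p@(p₁ , p₂) q@(q₁ , q₂) r@(r₁ , r₂) nc (a , b , c , ab≢0 , on-p , on-q , on-r) =
  ab≢0 (null-cong (λ n → sym (minus-0 (seq a n))) (null-cancel D D≢0 Da)
       , null-cong (λ n → sym (minus-0 (seq b n))) (null-cancel D D≢0 Db))
  where
  D : ℚ
  D = ℚDet.det₃ (ι₂ p) (ι₂ q) (ι₂ r)
  D≢0 : D ≢ 0ℚ
  D≢0 eq = ι≢0 (det₃≢0 nc) (trans (ι-det₃ p q r) eq)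
  line : ℚ × ℚ → ℕ → ℚ
  line x n = line-form (seq a n) (seq b n) (seq c n) x
  q-p : Null (λ n → line (ι₂ q) n ℚ.- line (ι₂ p) n)
  q-p = null-- on-q on-p
  r-p : Null (λ n → line (ι₂ r) n ℚ.- line (ι₂ p) n)
  r-p = null-- on-r on-p
  Da : Null (λ n → D ℚ.* seq a n)
  Da = null-cong
    (λ n → line-cramer₁ (seq a n) (seq b n) (seq c n) (ι p₁) (ι p₂) (ι q₁) (ι q₂) (ι r₁) (ι r₂))
    (null-- (null-* (fromℚ (ι r₂ ℚ.- ι p₂)) q-p) (null-* (fromℚ (ι q₂ ℚ.- ι p₂)) r-p))
  Db : Null (λ n → D ℚ.* seq b n)
  Db = null-cong
    (λ n → line-cramer₂ (seq a n) (seq b n) (seq c n) (ι p₁) (ι p₂) (ι q₁) (ι q₂) (ι r₁) (ι r₂))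
    (null-- (null-* (fromℚ (ι q₁ ℚ.- ι p₁)) r-p) (null-* (fromℚ (ι r₁ ℚ.- ι p₁)) q-p))

not-concyclic : ∀ p q r s → Nonconcyclic p q r s → ¬ Concyclic ⟦ p ⟧ ⟦ q ⟧ ⟦ r ⟧ ⟦ s ⟧
not-concyclic p@(p₁ , p₂) q@(q₁ , q₂) r@(r₁ , r₂) s@(s₁ , s₂) nc
  ((o₁ , o₂) , ρ , _ , (_ , on-p) , (_ , on-q) , (_ , on-r) , (_ , on-s)) =
  ι≢0 (det₄≢0 nc) (trans (ι-det₄ p q r s) (null-const (ℚDet.det₄ (ι₂ p) (ι₂ q) (ι₂ r) (ι₂ s)) det≈0))
  where
  circle : ℚ × ℚ → ℕ → ℚ
  circle x n = circle-form (seq ρ n) (seq o₁ n , seq o₂ n) x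
  cofactor : ℤ × ℤ → ℤ × ℤ → ℝ
  cofactor u v = fromℚ (ℚDet.cross (ι₂ u ℚDet.⊟ ι₂ p) (ι₂ v ℚDet.⊟ ι₂ p))
  p-q : Null (λ n → circle (ι₂ p) n ℚ.- circle (ι₂ q) n)
  p-q = null-- on-p on-q
  p-r : Null (λ n → circle (ι₂ p) n ℚ.- circle (ι₂ r) n)
  p-r = null-- on-p on-r
  p-s : Null (λ n → circle (ι₂ p) n ℚ.- circle (ι₂ s) n)
  p-s = null-- on-p on-s
  det≈0 : Null (λ _ → ℚDet.det₄ (ι₂ p) (ι₂ q) (ι₂ r) (ι₂ s))
  det≈0 = null-cong (λ n → circle-expand (seq ρ n) (seq o₁ n) (seq o₂ n)
      (ι p₁) (ι p₂) (ι q₁) (ι q₂) (ι r₁) (ι r₂) (ι s₁) (ι s₂))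
    (null-+ (null-- (null-* (cofactor r s) p-q) (null-* (cofactor q s) p-r))
      (null-* (cofactor q r) p-s))

-- Uniqueness of norms, arccosines and angles.

p≤∣p∣ : ∀ p → p ℚ.≤ ℚ.∣ p ∣
p≤∣p∣ p with ℚ.≤-total 0ℚ p
... | inj₁ 0≤p = ℚ.≤-reflexive (sym (ℚ.0≤p⇒∣p∣≡p 0≤p))
... | inj₂ p≤0 = ℚ.≤-trans p≤0 (ℚ.0≤∣p∣ p)

p≤q+∣p-q∣ : ∀ p q → p ℚ.≤ q ℚ.+ ℚ.∣ p ℚ.- q ∣
p≤q+∣p-q∣ p q = subst (ℚ._≤ q ℚ.+ ℚ.∣ p ℚ.- q ∣)
  (solve 2 (λ p q → q :+ (p :- q) := p) refl p q) (ℚ.+-monoʳ-≤ q (p≤∣p∣ (p ℚ.- q)))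
  where open ℚ-Syntax

∣p-q∣≡∣q-p∣ : ∀ p q → ℚ.∣ p ℚ.- q ∣ ≡ ℚ.∣ q ℚ.- p ∣
∣p-q∣≡∣q-p∣ p q = trans (sym (ℚ.∣-p∣≡∣p∣ (p ℚ.- q)))
  (cong ℚ.∣_∣ (solve 2 (λ p q → :- (p :- q) := q :- p) refl p q))
  where open ℚ-Syntax

dist-≤ : ∀ p q {e} → ℚ.∣ p ℚ.- q ∣ ℚ.≤ e → p ℚ.≤ q ℚ.+ e
dist-≤ p q {e} h = ℚ.≤-trans (p≤q+∣p-q∣ p q) (ℚ.+-monoʳ-≤ q h)

dist-≤′ : ∀ p q {e} → ℚ.∣ p ℚ.- q ∣ ℚ.≤ e → q ℚ.≤ p ℚ.+ e
dist-≤′ p q {e} h = dist-≤ q p (subst (λ x → x ℚ.≤ e) (∣p-q∣≡∣q-p∣ p q) h)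

0<q-p : ∀ {p q} → p ℚ.< q → 0ℚ ℚ.< q ℚ.- p
0<q-p {p} {q} p<q = subst (λ x → x ℚ.< q ℚ.- p) (ℚ.+-inverseʳ p) (ℚ.+-monoˡ-< (ℚ.- p) p<q)

<-apart : ∀ (x y : ℝ) z e → e ℚ.< z →
  (∃[ N ] ∀ n → N ℕ.≤ n → ℚ.∣ (seq x n ℚ.- seq y n) ℚ.- z ∣ ℚ.≤ e) → y < x
<-apart x y z e e<z (N , h) = z ℚ.- e , 0<q-p {e} {z} e<z , N , λ n n≥ →
  subst₂ ℚ._≤_ (left (seq y n) z e) (right (seq x n) (seq y n) e)
    (ℚ.+-monoʳ-≤ (seq y n ℚ.- e) (dist-≤′ (seq x n ℚ.- seq y n) z {e} (h n n≥)))
  where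
  open ℚ-Syntax
  left : ∀ b z e → b ℚ.- e ℚ.+ z ≡ b ℚ.+ (z ℚ.- e)
  left = solve 3 (λ b z e → b :- e :+ z := b :+ (z :- e)) refl
  right : ∀ a b e → b ℚ.- e ℚ.+ (a ℚ.- b ℚ.+ e) ≡ a
  right = solve 3 (λ a b e → b :- e :+ (a :- b :+ e) := a) refl

-- The rational `z`, the difference at a late index, can be compared with ε/2 decidably; were ∣z∣
-- larger, the Cauchy property would keep `x` and `y` apart in one direction or the other.
≈-tight : ∀ x y → ¬ x < y → ¬ y < x → x ≈ y
≈-tight x y x≮y y≮x ε 0<ε = N , λ n n≥ → subst₂ ℚ._≤_
  (cong ℚ.∣_∣ (restore (seq x n ℚ.- seq y n) z)) (two-halves ε)
  (ℚ.≤-trans (ℚ.∣p+q∣≤∣p∣+∣q∣ ((seq x n ℚ.- seq y n) ℚ.- z) z)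
    (ℚ.+-mono-≤ {ℚ.∣ (seq x n ℚ.- seq y n) ℚ.- z ∣} {e} {ℚ.∣ z ∣} {e} (near n n≥) ∣z∣≤e))
  where
  e = ε ℚ.* ½
  N = proj₁ (cauchy (x - y) e (halve {ε} 0<ε))
  z = seq x N ℚ.- seq y N
  restore : ∀ a z → a ℚ.- z ℚ.+ z ≡ a
  restore = solve 2 (λ a z → a :- z :+ z := a) refl
    where open ℚ-Syntax
  flip : ∀ a b z → ℚ.- (a ℚ.- b ℚ.- z) ≡ b ℚ.- a ℚ.- (ℚ.- z)
  flip = solve 3 (λ a b z → :- (a :- b :- z) := b :- a :- (:- z)) refl
    where open ℚ-Syntax
  near : ∀ n → N ℕ.≤ n → ℚ.∣ (seq x n ℚ.- seq y n) ℚ.- z ∣ ℚ.≤ e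
  near n n≥ = proj₂ (cauchy (x - y) e (halve {ε} 0<ε)) n N n≥ ℕ.≤-refl
  near′ : ∀ n → N ℕ.≤ n → ℚ.∣ (seq y n ℚ.- seq x n) ℚ.- (ℚ.- z) ∣ ℚ.≤ e
  near′ n n≥ = subst (λ w → w ℚ.≤ e)
    (trans (sym (ℚ.∣-p∣≡∣p∣ (seq x n ℚ.- seq y n ℚ.- z))) (cong ℚ.∣_∣ (flip (seq x n) (seq y n) z)))
    (near n n≥)
  e≮∣z∣ : ¬ e ℚ.< ℚ.∣ z ∣
  e≮∣z∣ e<∣z∣ with ℚ.∣p∣≡p∨∣p∣≡-p z
  ... | inj₁ eq = y≮x (<-apart x y z e (subst (λ w → e ℚ.< w) eq e<∣z∣) (N , near))
  ... | inj₂ eq = x≮y (<-apart y x (ℚ.- z) e (subst (λ w → e ℚ.< w) eq e<∣z∣) (N , near′))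
  ∣z∣≤e : ℚ.∣ z ∣ ℚ.≤ e
  ∣z∣≤e = ℚ.≮⇒≥ e≮∣z∣

≈-sym : ∀ {x y} → x ≈ y → y ≈ x
≈-sym {x} {y} h ε 0<ε = let N , b = h ε 0<ε in N , λ n n≥ →
  subst (λ w → w ℚ.≤ ε) (∣p-q∣≡∣q-p∣ (seq x n) (seq y n)) (b n n≥)

≈-trans : ∀ {x y z} → x ≈ y → y ≈ z → x ≈ z
≈-trans {x} {y} {z} h k = null-cong
  (λ n → solve 3 (λ x y z → x :- y :+ (y :- z) := x :- z) refl (seq x n) (seq y n) (seq z n))
  (null-+ h k)
  where open ℚ-Syntax

<-dominateˡ : ∀ {x y : ℝ} (x′ : ℝ) → x < y →
  (∃[ N ] ∀ n → N ℕ.≤ n → seq x′ n ℚ.≤ seq x n) → x′ < y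
<-dominateˡ {x} {y} x′ (ε , 0<ε , M , h) (N , k) = ε , 0<ε , M ℕ.+ N , λ n n≥ →
  ℚ.≤-trans (ℚ.+-monoˡ-≤ ε (k n (ℕ.≤-trans (ℕ.m≤n+m N M) n≥))) (h n (ℕ.≤-trans (ℕ.m≤m+n M N) n≥))

<-dominateʳ : ∀ {x y : ℝ} (y′ : ℝ) → x < y →
  (∃[ N ] ∀ n → N ℕ.≤ n → seq y n ℚ.≤ seq y′ n) → x < y′
<-dominateʳ {x} {y} y′ (ε , 0<ε , M , h) (N , k) = ε , 0<ε , M ℕ.+ N , λ n n≥ →
  ℚ.≤-trans (h n (ℕ.≤-trans (ℕ.m≤m+n M N) n≥)) (k n (ℕ.≤-trans (ℕ.m≤n+m N M) n≥))

⟶-resp-≈ : ∀ xs l l′ → l ≈ l′ → xs ⟶ l → xs ⟶ l′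
⟶-resp-≈ xs l l′ l≈l′ h ε 0<ε =
  let e       = ε ℚ.* ½
      N , b   = h e (halve {ε} 0<ε)
      M , d   = l≈l′ e (halve {ε} 0<ε)
  in N , λ n n≥ → let lo , hi = b n n≥ in
    <-dominateˡ {l - fromℚ e} {xs n} (l′ - fromℚ ε) lo (M , λ k k≥ →
      subst₂ ℚ._≤_ (cong (λ t → seq l′ k ℚ.- t) (two-halves ε)) (lower (seq l k) e)
        (ℚ.+-monoˡ-≤ (ℚ.- (e ℚ.+ e)) (dist-≤′ (seq l k) (seq l′ k) {e} (d k k≥)))) ,
    <-dominateʳ {xs n} {l + fromℚ e} (l′ + fromℚ ε) hi (M , λ k k≥ →
      subst (λ w → seq l k ℚ.+ e ℚ.≤ w)
        (trans (ℚ.+-assoc (seq l′ k) e e) (cong (λ t → seq l′ k ℚ.+ t) (two-halves ε)))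
        (ℚ.+-monoˡ-≤ e (dist-≤ (seq l k) (seq l′ k) {e} (d k k≥))))
  where
  lower : ∀ a e → a ℚ.+ e ℚ.- (e ℚ.+ e) ≡ a ℚ.- e
  lower = solve 2 (λ a e → a :+ e :- (e :+ e) := a :- e) refl
    where open ℚ-Syntax

-- Each angle is least among the nonnegative numbers with its cosine, and the cosines agree, so
-- neither angle is below the other.
arccos-unique : ∀ {c c′ θ θ′} → c ≈ c′ → IsArccos c θ → IsArccos c′ θ′ → θ ≈ θ′
arccos-unique {c} {c′} {θ} {θ′} c≈c′ (0≤θ , cosθ , θ-least) (0≤θ′ , cosθ′ , θ′-least) =
  ≈-tight θ θ′
    (θ′-least θ 0≤θ (⟶-resp-≈ (cosSums θ) c c′ c≈c′ cosθ))
    (θ-least θ′ 0≤θ′ (⟶-resp-≈ (cosSums θ′) c′ c (≈-sym {c} {c′} c≈c′) cosθ′))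
  where
  cosSums : ℝ → ℕ → ℝ
  cosSums φ n = sum {n} (λ k → cosTerm φ (toℕ k))

null-cancel-apart : ∀ (z : ℕ → ℚ) {f} δ → 0ℚ ℚ.< δ → (∃[ N ] ∀ n → N ℕ.≤ n → δ ℚ.≤ z n) →
  Null (λ n → z n ℚ.* f n) → Null f
null-cancel-apart z {f} δ 0<δ (M , δ≤z) h ε 0<ε =
  let N , b = h (δ ℚ.* ε) (*-pos {δ} {ε} 0<δ 0<ε)
  in M ℕ.+ N , λ n n≥ →
    let δ≤zn = δ≤z n (ℕ.≤-trans (ℕ.m≤m+n M N) n≥)
        0≤zn = ℚ.<⇒≤ (ℚ.<-≤-trans 0<δ δ≤zn)
    in ℚ.*-cancelˡ-≤-pos {ℚ.∣ f n ∣} {ε} δ {{ℚ.positive 0<δ}} (begin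
      δ ℚ.* ℚ.∣ f n ∣            ≤⟨ ℚ.*-monoʳ-≤-nonNeg ℚ.∣ f n ∣ {{ℚ.nonNegative (ℚ.0≤∣p∣ (f n))}} δ≤zn ⟩
      z n ℚ.* ℚ.∣ f n ∣          ≡⟨ cong (λ t → t ℚ.* ℚ.∣ f n ∣) (ℚ.0≤p⇒∣p∣≡p 0≤zn) ⟨
      ℚ.∣ z n ∣ ℚ.* ℚ.∣ f n ∣    ≡⟨ ℚ.∣p*q∣≡∣p∣*∣q∣ (z n) (f n) ⟨
      ℚ.∣ z n ℚ.* f n ∣          ≤⟨ b n (ℕ.≤-trans (ℕ.m≤n+m N M) n≥) ⟩
      δ ℚ.* ε                    ∎)
  where open ℚ.≤-Reasoning

-- From r < s and r² ≈ s² it follows that s ≈ - r, so r is negative.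
square-root-≮ : ∀ r s → fromℕ 0 ≤ r → r * r ≈ s * s → ¬ r < s
square-root-≮ r s 0≤r rr≈ss (δ , 0<δ , M , gap) = 0≤r (e , 0<e ,
    M ℕ.+ proj₁ sum-small , λ n n≥ → negative n
      (gap n (ℕ.≤-trans (ℕ.m≤m+n M _) n≥))
      (proj₂ sum-small n (ℕ.≤-trans (ℕ.m≤n+m (proj₁ sum-small) M) n≥)))
  where
  open ℚ-Syntax
  factor : ∀ a b → ℚ.- (a ℚ.* a ℚ.- b ℚ.* b) ≡ (b ℚ.- a) ℚ.* (a ℚ.+ b)
  factor = solve 2 (λ a b → :- (a :* a :- b :* b) := (b :- a) :* (a :+ b)) refl
  sum-null : Null (λ n → seq r n ℚ.+ seq s n)
  sum-null = null-cancel-apart (λ n → seq s n ℚ.- seq r n) δ 0<δ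
    (M , λ n n≥ → subst (λ w → w ℚ.≤ seq s n ℚ.- seq r n) (cancel (seq r n) δ)
      (ℚ.+-monoˡ-≤ (ℚ.- seq r n) (gap n n≥)))
    (null-cong (λ n → factor (seq r n) (seq s n)) (null-neg rr≈ss))
    where
    cancel : ∀ a d → a ℚ.+ d ℚ.- a ≡ d
    cancel = solve 2 (λ a d → a :+ d :- a := d) refl
  -- A quarter of δ: from r + 4e ≤ s and r + s ≤ e follows 2r ≤ - 3e, hence r ≤ - e.
  e = δ ℚ.* ½ ℚ.* ½
  0<e : 0ℚ ℚ.< e
  0<e = halve {δ ℚ.* ½} (halve {δ} 0<δ)
  sum-small = sum-null e 0<e
  δ≡4e : e ℚ.+ e ℚ.+ (e ℚ.+ e) ≡ δ
  δ≡4e = trans (cong (λ t → t ℚ.+ t) (two-halves (δ ℚ.* ½))) (two-halves δ)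
  regroup : ∀ a e → a ℚ.+ e ℚ.+ (a ℚ.+ e ℚ.+ e) ≡ a ℚ.+ (e ℚ.+ e ℚ.+ (e ℚ.+ e)) ℚ.+ a ℚ.- e
  regroup = solve 2 (λ a e → a :+ e :+ (a :+ e :+ e) := a :+ (e :+ e :+ (e :+ e)) :+ a :- e) refl
  negative : ∀ n → seq r n ℚ.+ δ ℚ.≤ seq s n → ℚ.∣ seq r n ℚ.+ seq s n ∣ ℚ.≤ e →
    seq r n ℚ.+ e ℚ.≤ 0ℚ
  negative n r+δ≤s small = ℚ.≮⇒≥ λ 0<r+e → ℚ.<-irrefl {0ℚ} refl (begin-strict
    0ℚ                                      <⟨ ℚ.+-mono-< {0ℚ} {a ℚ.+ e} {0ℚ} {a ℚ.+ e ℚ.+ e} 0<r+e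
                                                 (ℚ.+-mono-< {0ℚ} {a ℚ.+ e} {0ℚ} {e} 0<r+e 0<e) ⟩
    a ℚ.+ e ℚ.+ (a ℚ.+ e ℚ.+ e)             ≡⟨ regroup a e ⟩
    a ℚ.+ (e ℚ.+ e ℚ.+ (e ℚ.+ e)) ℚ.+ a ℚ.- e  ≡⟨ cong (λ t → a ℚ.+ t ℚ.+ a ℚ.- e) δ≡4e ⟩
    a ℚ.+ δ ℚ.+ a ℚ.- e                     ≤⟨ ℚ.+-monoˡ-≤ (ℚ.- e) (ℚ.+-monoˡ-≤ a r+δ≤s) ⟩
    b ℚ.+ a ℚ.- e                           ≡⟨ cong (λ t → t ℚ.- e) (ℚ.+-comm b a) ⟩
    a ℚ.+ b ℚ.- e                           ≤⟨ ℚ.+-monoˡ-≤ (ℚ.- e) (ℚ.≤-trans (p≤∣p∣ (a ℚ.+ b)) small) ⟩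
    e ℚ.- e                                 ≡⟨ ℚ.+-inverseʳ e ⟩
    0ℚ                                      ∎)
    where
    open ℚ.≤-Reasoning
    a = seq r n
    b = seq s n

norm-unique : ∀ {u r s} → IsNorm u r → IsNorm u s → r ≈ s
norm-unique {u} {r} {s} (0≤r , rr≈uu) (0≤s , ss≈uu) = ≈-tight r s
  (square-root-≮ r s 0≤r (≈-trans {r * r} {u ∙ u} {s * s} rr≈uu (≈-sym {s * s} {u ∙ u} ss≈uu)))
  (square-root-≮ s r 0≤s (≈-trans {s * s} {u ∙ u} {r * r} ss≈uu (≈-sym {r * r} {u ∙ u} rr≈uu)))

-- Multiplying once more by `a * b` turns the factor into a²b² ≈ A B, so only nonzero rationals have
-- to be cancelled, never the real norms.
cosine-unique : ∀ A B {a b c c′} D → A ≢ 0ℚ → B ≢ 0ℚ → a * a ≈ fromℚ A → b * b ≈ fromℚ B →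
  c * (a * b) ≈ D → c′ * (a * b) ≈ D → c ≈ c′
cosine-unique A B {a} {b} {c} {c′} D A≢0 B≢0 aa≈A bb≈B cab≈D c′ab≈D =
  null-cancel A A≢0 (null-cancel B B≢0 (null-cong
    (λ n → identity (seq a n) (seq b n) (seq c n) (seq c′ n) A B (seq D n))
    (null-- (null-* (a * b) (null-- cab≈D c′ab≈D))
      (null-* (c - c′) (null-+ (null-* (b * b) aa≈A) (null-* (fromℚ A) bb≈B))))))
  where
  open ℚ-Syntax
  identity : ∀ a b c c′ A B D →
    (a ℚ.* b) ℚ.* ((c ℚ.* (a ℚ.* b) ℚ.- D) ℚ.- (c′ ℚ.* (a ℚ.* b) ℚ.- D)) ℚ.-
    (c ℚ.- c′) ℚ.* ((b ℚ.* b) ℚ.* (a ℚ.* a ℚ.- A) ℚ.+ A ℚ.* (b ℚ.* b ℚ.- B)) ≡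
    B ℚ.* (A ℚ.* (c ℚ.- c′))
  identity = solve 7 (λ a b c c′ A B D →
    (a :* b) :* ((c :* (a :* b) :- D) :- (c′ :* (a :* b) :- D)) :-
    (c :- c′) :* ((b :* b) :* (a :* a :- A) :+ A :* (b :* b :- B)) :=
    B :* (A :* (c :- c′))) refl

-- The differences are formed in ℤ, where equality is propositional, so that an angle at another
-- vertex can be transported by `subst₂`.
IsAngleBetween : (u v : ℤ × ℤ) → ℝ → Set
IsAngleBetween u v θ = ∃[ a ] ∃[ b ] ∃[ c ]
  IsNorm ⟦ u ⟧ a × IsNorm ⟦ v ⟧ b × c * (a * b) ≈ ⟦ u ⟧ ∙ ⟦ v ⟧ × IsArccos c θ

dot-⊟ : ∀ p q r → ℚDet.dot (ι₂ p ℚDet.⊟ ι₂ q) (ι₂ r ℚDet.⊟ ι₂ q) ≡ ℚDet.dot (ι₂ (p ⊟ q)) (ι₂ (r ⊟ q))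
dot-⊟ p q r = cong₂ ℚDet.dot (sym (ι-⊟ p q)) (sym (ι-⊟ r q))

angle-between : ∀ p q r {θ} → IsAngle ⟦ p ⟧ ⟦ q ⟧ ⟦ r ⟧ θ → IsAngleBetween (p ⊟ q) (r ⊟ q) θ
angle-between p q r (a , b , c , (0≤a , aa) , (0≤b , bb) , cab , arc) = a , b , c ,
  (0≤a , null-cong (λ n → cong (λ t → seq a n ℚ.* seq a n ℚ.- t) (dot-⊟ p q p)) aa) ,
  (0≤b , null-cong (λ n → cong (λ t → seq b n ℚ.* seq b n ℚ.- t) (dot-⊟ r q r)) bb) ,
  null-cong (λ n → cong (λ t → seq c n ℚ.* (seq a n ℚ.* seq b n) ℚ.- t) (dot-⊟ p q r)) cab ,
  arc

angle-between-unique : ∀ u v {θ θ′} → sq u ≢ 0ℤ → sq v ≢ 0ℤ →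
  IsAngleBetween u v θ → IsAngleBetween u v θ′ → θ ≈ θ′
angle-between-unique u v {θ} {θ′} u≢0 v≢0
  (a , b , c , na , nb , cab , arc) (a′ , b′ , c′ , na′ , nb′ , cab′ , arc′) =
  arccos-unique {c} {c′} {θ} {θ′} c≈c′ arc arc′
  where
  A = ℚDet.sq (ι₂ u)
  B = ℚDet.sq (ι₂ v)
  a′≈a : a′ ≈ a
  a′≈a = norm-unique {⟦ u ⟧} {a′} {a} na′ na
  b′≈b : b′ ≈ b
  b′≈b = norm-unique {⟦ v ⟧} {b′} {b} nb′ nb
  transfer : ∀ a b c a′ b′ D →
    c ℚ.* (a′ ℚ.* b′) ℚ.- D ℚ.- ((c ℚ.* b′) ℚ.* (a′ ℚ.- a) ℚ.+ (c ℚ.* a) ℚ.* (b′ ℚ.- b)) ≡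
    c ℚ.* (a ℚ.* b) ℚ.- D
  transfer = solve 6 (λ a b c a′ b′ D →
    c :* (a′ :* b′) :- D :- ((c :* b′) :* (a′ :- a) :+ (c :* a) :* (b′ :- b)) :=
    c :* (a :* b) :- D) refl
    where open ℚ-Syntax
  c′ab : c′ * (a * b) ≈ ⟦ u ⟧ ∙ ⟦ v ⟧
  c′ab = null-cong
    (λ n → transfer (seq a n) (seq b n) (seq c′ n) (seq a′ n) (seq b′ n) (ℚDet.dot (ι₂ u) (ι₂ v)))
    (null-- cab′ (null-+ (null-* (c′ * b′) a′≈a) (null-* (c′ * a) b′≈b)))
  c≈c′ : c ≈ c′
  c≈c′ = cosine-unique A B {a} {b} {c} {c′} (⟦ u ⟧ ∙ ⟦ v ⟧)
    (λ eq → ι≢0 u≢0 (trans (ι-dot u u) eq)) (λ eq → ι≢0 v≢0 (trans (ι-dot v v) eq))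
    (proj₂ na) (proj₂ nb) cab c′ab

-- Counting angles

-- `Q` need not be decidable; under the double negation it may be asked whether a smaller witness
-- exists, and `b` bounds the descent.
least : ∀ (Q : ℕ → Set) n → Q n → ¬ ¬ (∃[ m ] m ℕ.≤ n × Q m × (∀ j → Q j → m ℕ.≤ j))
least Q n q = below n n ℕ.≤-refl q
  where
  below : ∀ b k → k ℕ.≤ b → Q k → ¬ ¬ (∃[ m ] m ℕ.≤ k × Q m × (∀ j → Q j → m ℕ.≤ j))
  below zero    zero _   q ¬m = ¬m (0 , ℕ.z≤n , q , λ _ _ → ℕ.z≤n)
  below (suc b) k    k≤b q ¬m = ¬¬-excluded-middle {A = ∃[ j ] j ℕ.< k × Q j} λ
    { (yes (j , j<k , qj)) → below b j (ℕ.≤-pred (ℕ.≤-trans j<k k≤b)) qj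
        λ (m , m≤j , rest) → ¬m (m , ℕ.≤-trans m≤j (ℕ.<⇒≤ j<k) , rest)
    ; (no none) → ¬m (k , ℕ.≤-refl , q , λ j qj → ℕ.≮⇒≥ λ j<k → none (j , j<k , qj))
    }

-- Each class contributes at most one real. Excluded middle under the double negation settles
-- whether the class is inhabited and whether its value is already listed.
finite-cardinality : ∀ N (K : Fin N → ℝ → Set) → (∀ c x y → K c x → K c y → x ≈ y) →
  ¬ ¬ (∃[ k ] k ℕ.≤ N × HasCardinality (λ x → ∃[ c ] K c x) k)
finite-cardinality zero    K uniq ¬card =
  ¬card (0 , ℕ.z≤n , (λ ()) , (λ { {()} }) , (λ ()) , λ { _ (() , _) })
finite-cardinality (suc N) K uniq ¬card =
  finite-cardinality N (K ∘ suc) (λ c → uniq (suc c)) λ (k , k≤N , v , v-inj , v∈ , covers) →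
  ¬¬-excluded-middle {A = ∃[ x ] K zero x} λ
    { (no none) → ¬card (k , ℕ.m≤n⇒m≤1+n k≤N , v , v-inj , (λ i → let c , h = v∈ i in suc c , h) ,
        λ { x (zero , h) → contradiction (x , h) none ; x (suc c , h) → covers x (c , h) })
    ; (yes (x₀ , x₀∈)) → ¬¬-excluded-middle {A = ∃[ i ] x₀ ≈ v i} λ
      { (yes (i , x₀≈vi)) → ¬card (k , ℕ.m≤n⇒m≤1+n k≤N , v , v-inj , (λ i → let c , h = v∈ i in suc c , h) ,
          λ { x (zero , h)  → i , ≈-trans {x} {x₀} {v i} (uniq zero x x₀ h x₀∈) x₀≈vi
            ; x (suc c , h) → covers x (c , h) })
      ; (no new) → ¬card (suc k , ℕ.s≤s k≤N , (λ { zero → x₀ ; (suc i) → v i }) ,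
          (λ { {zero}  {zero}  _ → refl
             ; {zero}  {suc j} e → contradiction (j , e) new
             ; {suc i} {zero}  e → contradiction (i , ≈-sym {v i} {x₀} e) new
             ; {suc i} {suc j} e → cong suc (v-inj e) }) ,
          (λ { zero → zero , x₀∈ ; (suc i) → let c , h = v∈ i in suc c , h }) ,
          λ { x (zero , h)  → zero , uniq zero x x₀ h x₀∈
            ; x (suc c , h) → let i , e = covers x (c , h) in suc i , e })
      }
    }

-- Coding triples of cube vertices by words over seven digits.

encode : ∀ {b d} → Vec (Fin b) d → Fin (b ℕ.^ d)
encode []       = zero
encode (i ∷ v) = combine i (encode v)

encode-injective : ∀ {b d} (v w : Vec (Fin b) d) → encode v ≡ encode w → v ≡ w
encode-injective []      []      _  = refl
encode-injective (i ∷ v) (j ∷ w) eq =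
  let i≡j , v≡w = Fin.combine-injective i (encode v) j (encode w) eq
  in cong₂ _∷_ i≡j (encode-injective v w v≡w)

decode : ∀ {b} d → Fin (b ℕ.^ d) → Vec (Fin b) d
decode zero        _ = []
decode {b} (suc d) i = let q , r = remQuot (b ℕ.^ d) i in q ∷ decode d r

encode-decode : ∀ {b} d (i : Fin (b ℕ.^ d)) → encode (decode {b} d i) ≡ i
encode-decode zero        zero = refl
encode-decode {b} (suc d) i    =
  trans (cong (combine (proj₁ (remQuot {b} (b ℕ.^ d) i)))
      (encode-decode d (proj₂ (remQuot {b} (b ℕ.^ d) i))))
    (Fin.combine-remQuot {b} (b ℕ.^ d) i)

-- Of the eight triples of bits only 000 and 111 give the same pair of differences, namely (0 , 0);
-- this is the origin of the 7.
digit : Fin 2 → Fin 2 → Fin 2 → Fin 7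
digit 0F 0F 0F = 0F
digit 1F 1F 1F = 0F
digit 0F 0F 1F = 1F
digit 1F 0F 0F = 2F
digit 1F 0F 1F = 3F
digit 0F 1F 1F = 4F
digit 1F 1F 0F = 5F
digit 0F 1F 0F = 6F

-- The differences x - y and z - y of vertices x, y, z of the cube are
-- determined in each coordinate by one of seven digits.
code : ∀ {d} → Cube d → Cube d → Cube d → Vec (Fin 7) d
code []       []       []       = []
code (i ∷ x) (j ∷ y) (k ∷ z) = digit i j k ∷ code x y z

difference : Fin 2 → Fin 2 → ℤ × ℤ → ℤ × ℤ
difference 0F 0F v = 0ℤ , 0ℤ
difference 0F 1F v = ⊟ v
difference 1F 0F v = v
difference 1F 1F v = 0ℤ , 0ℤ

extend-⊟ : ∀ {d} (P : Cube d → ℤ × ℤ) v i j x y →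
  extend P v (i ∷ x) ⊟ extend P v (j ∷ y) ≡ (P x ⊟ P y) ⊞ difference i j v
extend-⊟ P v 0F 0F x y = cong₂ _,_ (sym (ℤ.+-identityʳ _)) (sym (ℤ.+-identityʳ _))
extend-⊟ P v 0F 1F x y = ⊟-⊞ (P x) (P y) v
  where
  ⊟-⊞ : ∀ p q v → p ⊟ (q ⊞ v) ≡ (p ⊟ q) ⊞ (⊟ v)
  ⊟-⊞ (p₁ , p₂) (q₁ , q₂) (v₁ , v₂) = cong₂ _,_ (f p₁ q₁ v₁) (f p₂ q₂ v₂)
    where
    f : ∀ p q v → p ℤ.- (q ℤ.+ v) ≡ p ℤ.- q ℤ.+ (ℤ.- v)
    f p q v = trans (cong (λ t → p ℤ.+ t) (ℤ.neg-distrib-+ q v)) (sym (ℤ.+-assoc p (ℤ.- q) (ℤ.- v)))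
extend-⊟ P v 1F 0F x y = ⊞-⊟-comm (P x) (P y) v
extend-⊟ P v 1F 1F x y = trans (⊟-translate (P x) (P y) v)
  (cong₂ _,_ (sym (ℤ.+-identityʳ _)) (sym (ℤ.+-identityʳ _)))

digit-left : Fin 7 → ℤ × ℤ → ℤ × ℤ
digit-left 0F = difference 0F 0F
digit-left 1F = difference 0F 0F
digit-left 2F = difference 1F 0F
digit-left 3F = difference 1F 0F
digit-left 4F = difference 0F 1F
digit-left 5F = difference 1F 1F
digit-left 6F = difference 0F 1F

digit-right : Fin 7 → ℤ × ℤ → ℤ × ℤ
digit-right 0F = difference 0F 0F
digit-right 1F = difference 1F 0F
digit-right 2F = difference 0F 0F
digit-right 3F = difference 1F 0F
digit-right 4F = difference 1F 1F
digit-right 5F = difference 0F 1F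
digit-right 6F = difference 0F 1F

difference-digit : ∀ i j k v →
  difference i j v ≡ digit-left (digit i j k) v × difference k j v ≡ digit-right (digit i j k) v
difference-digit 0F 0F 0F v = refl , refl
difference-digit 0F 0F 1F v = refl , refl
difference-digit 0F 1F 0F v = refl , refl
difference-digit 0F 1F 1F v = refl , refl
difference-digit 1F 0F 0F v = refl , refl
difference-digit 1F 0F 1F v = refl , refl
difference-digit 1F 1F 0F v = refl , refl
difference-digit 1F 1F 1F v = refl , refl

sum-digits : ∀ {d} → (Fin 7 → ℤ × ℤ → ℤ × ℤ) → Vec (ℤ × ℤ) d → Vec (Fin 7) d → ℤ × ℤ
sum-digits f []       []       = 0ℤ , 0ℤ
sum-digits f (v ∷ vs) (c ∷ cs) = sum-digits f vs cs ⊞ f c v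

cube-⊟ : ∀ {d} (vs : Vec (ℤ × ℤ) d) x y z →
  cube vs x ⊟ cube vs y ≡ sum-digits digit-left vs (code x y z) ×
  cube vs z ⊟ cube vs y ≡ sum-digits digit-right vs (code x y z)
cube-⊟ []       []      []      []      = refl , refl
cube-⊟ (v ∷ vs) (i ∷ x) (j ∷ y) (k ∷ z) =
  let left , right = cube-⊟ vs x y z
      dl , dr      = difference-digit i j k v
  in trans (extend-⊟ (cube vs) v i j x y) (cong₂ _⊞_ left dl) ,
     trans (extend-⊟ (cube vs) v k j z y) (cong₂ _⊞_ right dr)

sq-⊟≢0 : ∀ p q → p ≢ q → sq (p ⊟ q) ≢ 0ℤ
sq-⊟≢0 (p₁ , p₂) (q₁ , q₂) p≢q eq =
  let h₁ , h₂ = sq≡0 (p₁ ℤ.- q₁) (p₂ ℤ.- q₂) eq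
  in p≢q (cong₂ _,_ (ℤ.i-j≡0⇒i≡j p₁ q₁ h₁) (ℤ.i-j≡0⇒i≡j p₂ q₂ h₂))

-- The cube point set and the bound on its angles.

module CubePoints {n} d (n≤2^d : n ℕ.≤ 2 ℕ.^ d) where

  vectors : Vec (ℤ × ℤ) d
  vectors = proj₁ (generic-cube d)

  open Generic (proj₂ (generic-cube d))

  vertex : Fin n → Cube d
  vertex i = decode d (inject≤ i n≤2^d)

  vertex-injective : ∀ {i j} → vertex i ≡ vertex j → i ≡ j
  vertex-injective {i} {j} eq = Fin.inject≤-injective n≤2^d n≤2^d i j
    (trans (sym (encode-decode d _)) (trans (cong encode eq) (encode-decode d _)))

  vertex-≢ : ∀ {i j} → i ≢ j → vertex i ≢ vertex j
  vertex-≢ i≢j eq = i≢j (vertex-injective eq)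

  lattice : Fin n → ℤ × ℤ
  lattice i = cube vectors (vertex i)

  points : PointSet n
  points = record
    { point    = λ i → ⟦ lattice i ⟧
    ; distinct = λ {i} {j} eq → vertex-injective
        (inj (vertex i) (vertex j) (⟦⟧-injective (lattice i) (lattice j) eq))
    }
    where
    inj : ∀ x y → cube vectors x ≡ cube vectors y → x ≡ y
    inj x y eq with x ≟ᶜ y
    ... | yes x≡y = x≡y
    ... | no  x≢y = contradiction eq (injective x y x≢y)

  general-position : GeneralPosition points
  general-position =
    (λ i j k (ij , ik , jk) → not-collinear (lattice i) (lattice j) (lattice k)
      (not-on-line (vertex i) (vertex j) (vertex k) (vertex-≢ ij) (vertex-≢ ik) (vertex-≢ jk))) ,
    (λ i j k l ((ij , ik , jk) , il , jl , kl) →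
      not-concyclic (lattice i) (lattice j) (lattice k) (lattice l)
        (not-on-circle (vertex i) (vertex j) (vertex k) (vertex l)
          (vertex-≢ ij) (vertex-≢ ik) (vertex-≢ jk) (vertex-≢ il) (vertex-≢ jl) (vertex-≢ kl)))

  -- Sorts the angle values into classes with at most one value each, the form `finite-cardinality`
  -- asks for; a class may be empty.
  AngleOfCode : Fin (7 ℕ.^ d) → ℝ → Set
  AngleOfCode c θ = AngleValue points θ × ∃[ i ] ∃[ j ] ∃[ k ] Distinct₃ i j k ×
    IsAngle (point points i) (point points j) (point points k) θ ×
    encode (code (vertex i) (vertex j) (vertex k)) ≡ c

  angle-of-code-unique : ∀ c θ θ′ → AngleOfCode c θ → AngleOfCode c θ′ → θ ≈ θ′
  angle-of-code-unique c θ θ′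
    (_ , i , j , k , (ij , _ , jk) , angle , eq) (_ , i′ , j′ , k′ , _ , angle′ , eq′) =
    angle-between-unique (lattice i ⊟ lattice j) (lattice k ⊟ lattice j) {θ} {θ′}
      (sq-⊟≢0 (lattice i) (lattice j) (injective (vertex i) (vertex j) (vertex-≢ ij)))
      (sq-⊟≢0 (lattice k) (lattice j) (injective (vertex k) (vertex j) (vertex-≢ (jk ∘ sym))))
      (angle-between (lattice i) (lattice j) (lattice k) angle)
      (subst₂ (λ u v → IsAngleBetween u v θ′)
        (trans (proj₁ at′) (trans (cong (sum-digits digit-left vectors) (sym same)) (sym (proj₁ at))))
        (trans (proj₂ at′) (trans (cong (sum-digits digit-right vectors) (sym same)) (sym (proj₂ at))))
        (angle-between (lattice i′) (lattice j′) (lattice k′) angle′))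
    where
    at  = cube-⊟ vectors (vertex i) (vertex j) (vertex k)
    at′ = cube-⊟ vectors (vertex i′) (vertex j′) (vertex k′)
    same : code (vertex i) (vertex j) (vertex k) ≡ code (vertex i′) (vertex j′) (vertex k′)
    same = encode-injective _ _ (trans eq (sym eq′))

  few-angles : ¬ ¬ (∃[ k ] k ℕ.≤ 7 ℕ.^ d × IsA points k)
  few-angles ¬k = finite-cardinality (7 ℕ.^ d) AngleOfCode angle-of-code-unique
    λ (k , k≤ , v , v-inj , v∈ , covers) → ¬k (k , k≤ , v , v-inj ,
      (λ i → proj₁ (proj₂ (v∈ i))) ,
      λ { x s@(_ , i , j , k , distinct , angle) → covers x (_ , s , i , j , k , distinct , angle , refl) })

-- The cube points show that some value at most 7ᵈ is attained, and the least attained value can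
-- only be smaller.
Agen-bound : ∀ n d → n ℕ.≤ 2 ℕ.^ d → ¬ ¬ (∃[ m ] m ℕ.≤ 7 ℕ.^ d × IsAgen n m)
Agen-bound n d n≤2^d ¬m = few-angles λ (k , k≤ , isA) →
  least (λ k → ∃[ P ] (GeneralPosition {n} P × IsA P k)) k (points , general-position , isA)
    λ (m , m≤k , attained , minimal) → ¬m (m , ℕ.≤-trans m≤k k≤ , attained ,
      λ P j general isA → minimal j (P , general , isA))
  where open CubePoints d n≤2^d

-- Powers of rational numbers

*-monoˡ : ∀ r {p q} → 0ℚ ℚ.≤ r → p ℚ.≤ q → r ℚ.* p ℚ.≤ r ℚ.* q
*-monoˡ r 0≤r p≤q = ℚ.*-monoˡ-≤-nonNeg r {{ℚ.nonNegative 0≤r}} p≤q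

*-monoʳ : ∀ r {p q} → 0ℚ ℚ.≤ r → p ℚ.≤ q → p ℚ.* r ℚ.≤ q ℚ.* r
*-monoʳ r 0≤r p≤q = ℚ.*-monoʳ-≤-nonNeg r {{ℚ.nonNegative 0≤r}} p≤q

*-nonNeg : ∀ p q → 0ℚ ℚ.≤ p → 0ℚ ℚ.≤ q → 0ℚ ℚ.≤ p ℚ.* q
*-nonNeg p q 0≤p 0≤q = subst (λ t → t ℚ.≤ p ℚ.* q) (ℚ.*-zeroʳ p) (*-monoˡ p {0ℚ} {q} 0≤p 0≤q)

+-nonNeg : ∀ p q → 0ℚ ℚ.≤ p → 0ℚ ℚ.≤ q → 0ℚ ℚ.≤ p ℚ.+ q
+-nonNeg p q 0≤p 0≤q = ℚ.+-mono-≤ {0ℚ} {p} {0ℚ} {q} 0≤p 0≤q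

0≤q-p : ∀ {p q} → p ℚ.≤ q → 0ℚ ℚ.≤ q ℚ.- p
0≤q-p {p} {q} p≤q = subst (λ x → x ℚ.≤ q ℚ.- p) (ℚ.+-inverseʳ p) (ℚ.+-monoˡ-≤ (ℚ.- p) p≤q)

≤⇒≯ : ∀ {p q} → p ℚ.≤ q → ¬ q ℚ.< p
≤⇒≯ p≤q q<p = ℚ.<-irrefl refl (ℚ.<-≤-trans q<p p≤q)

0≤1 : 0ℚ ℚ.≤ 1ℚ
0≤1 = ℚ.<⇒≤ 0<1ℚ

^-nonNeg : ∀ a n → 0ℚ ℚ.≤ a → 0ℚ ℚ.≤ a ^ℚ n
^-nonNeg a zero    0≤a = 0≤1
^-nonNeg a (suc n) 0≤a = *-nonNeg a (a ^ℚ n) 0≤a (^-nonNeg a n 0≤a)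

^-pos : ∀ a n → 0ℚ ℚ.< a → 0ℚ ℚ.< a ^ℚ n
^-pos a zero    0<a = 0<1ℚ
^-pos a (suc n) 0<a = *-pos {a} {a ^ℚ n} 0<a (^-pos a n 0<a)

^-mono-≤ : ∀ a b n → 0ℚ ℚ.≤ a → a ℚ.≤ b → a ^ℚ n ℚ.≤ b ^ℚ n
^-mono-≤ a b zero    0≤a a≤b = ℚ.≤-refl
^-mono-≤ a b (suc n) 0≤a a≤b = ℚ.≤-trans
  (*-monoˡ a 0≤a (^-mono-≤ a b n 0≤a a≤b))
  (*-monoʳ (b ^ℚ n) (^-nonNeg b n (ℚ.≤-trans 0≤a a≤b)) a≤b)

^-cancel-< : ∀ a b n → 0ℚ ℚ.≤ b → a ^ℚ n ℚ.< b ^ℚ n → a ℚ.< b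
^-cancel-< a b n 0≤b lt = ℚ.≰⇒> λ b≤a → ≤⇒≯ (^-mono-≤ b a n 0≤b b≤a) lt

1^ : ∀ n → 1ℚ ^ℚ n ≡ 1ℚ
1^ zero    = refl
1^ (suc n) = trans (ℚ.*-identityˡ (1ℚ ^ℚ n)) (1^ n)

1≤^ : ∀ a n → 1ℚ ℚ.≤ a → 1ℚ ℚ.≤ a ^ℚ n
1≤^ a n 1≤a = subst (λ t → t ℚ.≤ a ^ℚ n) (1^ n) (^-mono-≤ 1ℚ a n 0≤1 1≤a)

^-comm : ∀ a m n → (a ^ℚ m) ^ℚ n ≡ (a ^ℚ n) ^ℚ m
^-comm a m n = trans (^ℚ-assocʳ a m n) (trans (cong (a ^ℚ_) (ℕ.*-comm m n)) (sym (^ℚ-assocʳ a n m)))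

ι-^ : ∀ b p → ι (+ (b ℕ.^ p)) ≡ ι (+ b) ^ℚ p
ι-^ b zero    = refl
ι-^ b (suc p) = trans (cong ι (ℤ.pos-* b (b ℕ.^ p))) (trans (ι-* (+ b) (+ (b ℕ.^ p)))
  (cong (λ t → ι (+ b) ℚ.* t) (ι-^ b p)))

ι-mono : ∀ {m n} → m ℕ.≤ n → ι (+ m) ℚ.≤ ι (+ n)
ι-mono m≤n = ι-mono-≤ (ℤ.+≤+ m≤n)

ι-mono-< : ∀ {m n} → m ℕ.< n → ι (+ m) ℚ.< ι (+ n)
ι-mono-< {m} {n} m<n = ℚ.≰⇒> λ n≤m → contradiction
  (ℤ.+-injective (ι-injective (ℚ.≤-antisym n≤m (ι-mono (ℕ.<⇒≤ m<n))))) (ℕ.<⇒≢ m<n ∘ sym)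

seq-^ : ∀ x n k → seq (x ^ n) k ≡ seq x k ^ℚ n
seq-^ x zero    k = refl
seq-^ x (suc n) k = cong (λ t → seq x k ℚ.* t) (seq-^ x n k)

-- In closed form n B^(n-1), the largest slope of the n-th power on [0 , B].
lipschitz : ℚ → ℕ → ℚ
lipschitz B zero    = 0ℚ
lipschitz B (suc n) = B ^ℚ n ℚ.+ B ℚ.* lipschitz B n

lipschitz-nonNeg : ∀ B n → 0ℚ ℚ.≤ B → 0ℚ ℚ.≤ lipschitz B n
lipschitz-nonNeg B zero    0≤B = ℚ.≤-refl
lipschitz-nonNeg B (suc n) 0≤B = +-nonNeg (B ^ℚ n) (B ℚ.* lipschitz B n) (^-nonNeg B n 0≤B)
  (*-nonNeg B (lipschitz B n) 0≤B (lipschitz-nonNeg B n 0≤B))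

^-lipschitz : ∀ a b B n → 0ℚ ℚ.≤ a → a ℚ.≤ b → b ℚ.≤ B →
  b ^ℚ n ℚ.≤ a ^ℚ n ℚ.+ (b ℚ.- a) ℚ.* lipschitz B n
^-lipschitz a b B zero    0≤a a≤b b≤B = ℚ.≤-reflexive (sym (trans
  (cong (λ t → 1ℚ ℚ.+ t) (ℚ.*-zeroʳ (b ℚ.- a)))
  (ℚ.+-identityʳ 1ℚ)))
^-lipschitz a b B (suc n) 0≤a a≤b b≤B = begin
  b ℚ.* b ^ℚ n
    ≤⟨ *-monoˡ b 0≤b (^-lipschitz a b B n 0≤a a≤b b≤B) ⟩
  b ℚ.* (a ^ℚ n ℚ.+ d ℚ.* K)
    ≡⟨ regroup a b (a ^ℚ n) K ⟩
  a ℚ.* a ^ℚ n ℚ.+ d ℚ.* (a ^ℚ n ℚ.+ b ℚ.* K)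
    ≤⟨ ℚ.+-monoʳ-≤ (a ℚ.* a ^ℚ n) (*-monoˡ d (0≤q-p a≤b)
         (ℚ.+-mono-≤ (^-mono-≤ a B n 0≤a (ℚ.≤-trans a≤b b≤B))
           (*-monoʳ K (lipschitz-nonNeg B n (ℚ.≤-trans 0≤b b≤B)) b≤B))) ⟩
  a ℚ.* a ^ℚ n ℚ.+ d ℚ.* (B ^ℚ n ℚ.+ B ℚ.* K) ∎
  where
  open ℚ.≤-Reasoning
  d = b ℚ.- a
  K = lipschitz B n
  0≤b = ℚ.≤-trans 0≤a a≤b
  regroup : ∀ a b A K → b ℚ.* (A ℚ.+ (b ℚ.- a) ℚ.* K) ≡ a ℚ.* A ℚ.+ (b ℚ.- a) ℚ.* (A ℚ.+ b ℚ.* K)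
  regroup = solve 4 (λ a b A K → b :* (A :+ (b :- a) :* K) := a :* A :+ (b :- a) :* (A :+ b :* K)) refl
    where open ℚ-Syntax

small-factor : ∀ K ε → 0ℚ ℚ.≤ K → 0ℚ ℚ.< ε →
  ∃[ δ ] 0ℚ ℚ.< δ × (∀ h → 0ℚ ℚ.≤ h → h ℚ.≤ δ → h ℚ.* K ℚ.≤ ε)
small-factor K ε 0≤K 0<ε =
  -- Division is by 1 + K because K may be zero.
  let δ , 0<δ , eq = divide (1ℚ ℚ.+ K) 0<1+K ε 0<ε
  in δ , 0<δ , λ h 0≤h h≤δ → ℚ.≤-trans (*-monoˡ h 0≤h K≤1+K)
       (ℚ.≤-trans (*-monoʳ (1ℚ ℚ.+ K) (ℚ.<⇒≤ 0<1+K) h≤δ)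
         (ℚ.≤-reflexive (trans (ℚ.*-comm δ (1ℚ ℚ.+ K)) eq)))
  where
  0<1+K : 0ℚ ℚ.< 1ℚ ℚ.+ K
  0<1+K = ℚ.+-mono-<-≤ {0ℚ} {1ℚ} {0ℚ} {K} 0<1ℚ 0≤K
  K≤1+K : K ℚ.≤ 1ℚ ℚ.+ K
  K≤1+K = subst (λ t → t ℚ.≤ 1ℚ ℚ.+ K) (ℚ.+-identityˡ K) (ℚ.+-monoˡ-≤ K 0≤1)

archimedean : ∀ x → ∃[ N ] x ℚ.≤ ι (+ N)
archimedean x@record{} = ℤ.∣ ℚ.↥ x ∣ , ℚ.toℚᵘ-cancel-≤ (ℚᵘ.≤-trans (ℚᵘ.*≤* le)
    (ℚᵘ.≤-reflexive (ℚᵘ.≃-sym (toℚᵘ-ι (+ ℤ.∣ ℚ.↥ x ∣)))))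
  where
  open ℤ.≤-Reasoning
  i≤∣i∣ : ∀ i → i ℤ.≤ + ℤ.∣ i ∣
  i≤∣i∣ (+ n)    = ℤ.≤-refl
  i≤∣i∣ -[1+ n ] = ℤ.-≤+
  le : ℚ.↥ x ℤ.* 1ℤ ℤ.≤ + ℤ.∣ ℚ.↥ x ∣ ℤ.* ℚ.↧ x
  le = begin
    ℚ.↥ x ℤ.* 1ℤ                      ≡⟨ ℤ.*-identityʳ (ℚ.↥ x) ⟩
    ℚ.↥ x                             ≤⟨ i≤∣i∣ (ℚ.↥ x) ⟩
    + ℤ.∣ ℚ.↥ x ∣                     ≤⟨ ℤ.+≤+ (ℕ.m≤m*n ℤ.∣ ℚ.↥ x ∣ (ℚ.↧ₙ x)) ⟩
    + (ℤ.∣ ℚ.↥ x ∣ ℕ.* ℚ.↧ₙ x)        ≡⟨ ℤ.pos-* ℤ.∣ ℚ.↥ x ∣ (ℚ.↧ₙ x) ⟩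
    + ℤ.∣ ℚ.↥ x ∣ ℤ.* ℚ.↧ x           ∎

0<ι-suc : ∀ k → 0ℚ ℚ.< ι (+ suc k)
0<ι-suc k = ι-mono-< {0} {suc k} (ℕ.s≤s ℕ.z≤n)

-- 1 / (k + 1), the mesh of the k-th grid on which roots are approximated.
step : ℕ → ℚ
step k = proj₁ (reciprocal (ι (+ suc k)) (0<ι-suc k))

0<step : ∀ k → 0ℚ ℚ.< step k
0<step k = proj₁ (proj₂ (reciprocal (ι (+ suc k)) (0<ι-suc k)))

suc*step : ∀ k → ι (+ suc k) ℚ.* step k ≡ 1ℚ
suc*step k = proj₂ (proj₂ (reciprocal (ι (+ suc k)) (0<ι-suc k)))

step-small : ∀ ε → 0ℚ ℚ.< ε → ∃[ N ] ∀ k → N ℕ.≤ k → step k ℚ.≤ ε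
step-small ε 0<ε =
  let r , 0<r , εr≡1 = reciprocal ε 0<ε
      N , r≤N        = archimedean r
  in N , λ k N≤k → begin
    step k                              ≡⟨ ℚ.*-identityʳ (step k) ⟨
    step k ℚ.* 1ℚ                       ≡⟨ cong (λ t → step k ℚ.* t) εr≡1 ⟨
    step k ℚ.* (ε ℚ.* r)                ≤⟨ *-monoˡ (step k) (ℚ.<⇒≤ (0<step k)) (*-monoˡ ε (ℚ.<⇒≤ 0<ε)
                                            (ℚ.≤-trans r≤N (ι-mono (ℕ.m≤n⇒m≤1+n N≤k)))) ⟩
    step k ℚ.* (ε ℚ.* ι (+ suc k))      ≡⟨ regroup (step k) ε (ι (+ suc k)) ⟩
    ε ℚ.* (ι (+ suc k) ℚ.* step k)      ≡⟨ cong (λ t → ε ℚ.* t) (suc*step k) ⟩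
    ε ℚ.* 1ℚ                            ≡⟨ ℚ.*-identityʳ ε ⟩
    ε                                   ∎
  where
  open ℚ.≤-Reasoning
  regroup : ∀ h e s → h ℚ.* (e ℚ.* s) ≡ e ℚ.* (s ℚ.* h)
  regroup = solve 3 (λ h e s → h :* (e :* s) := e :* (s :* h)) refl
    where open ℚ-Syntax

-- Roots of natural numbers

-- Raising `R` by one moves the index by at most one step. With `f j = j ^ q` this rounds roots down
-- to a grid; with `f j = 2 ^ j` it finds the dimension of the cube.
bracket : ∀ (f : ℕ → ℕ) → (∀ j → f j ℕ.< f (suc j)) → ∀ R → f 0 ℕ.≤ R →
  ∃[ j ] f j ℕ.≤ R × R ℕ.< f (suc j)
bracket f f↑ R f0≤R = subst (λ R → ∃[ j ] f j ℕ.≤ R × R ℕ.< f (suc j)) (ℕ.m+[n∸m]≡n f0≤R) (go (R ℕ.∸ f 0))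
  where
  go : ∀ t → ∃[ j ] f j ℕ.≤ f 0 ℕ.+ t × f 0 ℕ.+ t ℕ.< f (suc j)
  go zero    = 0 , ℕ.m≤m+n (f 0) 0 , subst (ℕ._< f 1) (sym (ℕ.+-identityʳ (f 0))) (f↑ 0)
  go (suc t) rewrite ℕ.+-suc (f 0) t with go t
  ... | j , lo , hi with f (suc j) ℕ.≤? suc (f 0 ℕ.+ t)
  ...   | yes le = suc j , le , ℕ.≤-<-trans hi (f↑ (suc j))
  ...   | no  ¬le = j , ℕ.m≤n⇒m≤1+n lo , ℕ.≰⇒> ¬le

dist-bound : ∀ p q e → p ℚ.≤ q ℚ.+ e → q ℚ.≤ p ℚ.+ e → ℚ.∣ p ℚ.- q ∣ ℚ.≤ e
dist-bound p q e p≤q+e q≤p+e with ℚ.∣p∣≡p∨∣p∣≡-p (p ℚ.- q)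
... | inj₁ eq = subst (λ t → t ℚ.≤ e) (sym eq) (subst (λ t → p ℚ.- q ℚ.≤ t) (cancel q e)
  (ℚ.+-monoˡ-≤ (ℚ.- q) p≤q+e))
  where
  cancel : ∀ q e → q ℚ.+ e ℚ.- q ≡ e
  cancel = solve 2 (λ q e → q :+ e :- q := e) refl
    where open ℚ-Syntax
... | inj₂ eq = subst (λ t → t ℚ.≤ e) (sym eq) (subst₂ ℚ._≤_ (flip p q) (cancel p e)
  (ℚ.+-monoˡ-≤ (ℚ.- p) q≤p+e))
  where
  flip : ∀ p q → q ℚ.- p ≡ ℚ.- (p ℚ.- q)
  flip = solve 2 (λ p q → q :- p := :- (p :- q)) refl
    where open ℚ-Syntax
  cancel : ∀ q e → q ℚ.+ e ℚ.- q ≡ e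
  cancel = solve 2 (λ q e → q :+ e :- q := e) refl
    where open ℚ-Syntax

-- The k-th approximation `u k` is the q-th root of `r` rounded down to a multiple of 1 / (k + 1),
-- found by integer comparison of q-th powers. Any number whose q-th power is at most `r` is then
-- below `u k + step k`, which also gives the Cauchy property.
module Root (r q-1 : ℕ) (1≤r : 1 ℕ.≤ r) where

  q : ℕ
  q = suc q-1

  scaled : ∀ k → ∃[ j ] j ℕ.^ q ℕ.≤ r ℕ.* suc k ℕ.^ q × r ℕ.* suc k ℕ.^ q ℕ.< suc j ℕ.^ q
  scaled k = bracket (ℕ._^ q) (λ j → ℕ.^-monoˡ-< q (ℕ.n<1+n j)) (r ℕ.* suc k ℕ.^ q) ℕ.z≤n

  j : ℕ → ℕ
  j k = proj₁ (scaled k)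

  u : ℕ → ℚ
  u k = ι (+ j k) ℚ.* step k

  0≤ι : ∀ n → 0ℚ ℚ.≤ ι (+ n)
  0≤ι n = ι-mono {0} {n} ℕ.z≤n

  0≤u : ∀ k → 0ℚ ℚ.≤ u k
  0≤u k = *-nonNeg (ι (+ j k)) (step k) (0≤ι (j k)) (ℚ.<⇒≤ (0<step k))

  0≤u+step : ∀ k → 0ℚ ℚ.≤ u k ℚ.+ step k
  0≤u+step k = +-nonNeg (u k) (step k) (0≤u k) (ℚ.<⇒≤ (0<step k))

  scale-^ : ∀ a k → (ι (+ a) ℚ.* step k) ^ℚ q ≡ ι (+ (a ℕ.^ q)) ℚ.* step k ^ℚ q
  scale-^ a k = trans (^ℚ-distrib-* (ι (+ a)) (step k) q) (cong (λ t → t ℚ.* step k ^ℚ q) (sym (ι-^ a q)))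

  r-scaled : ∀ k → ι (+ r) ≡ ι (+ (r ℕ.* suc k ℕ.^ q)) ℚ.* step k ^ℚ q
  r-scaled k = begin
    ι (+ r)                                             ≡⟨ ℚ.*-identityʳ (ι (+ r)) ⟨
    ι (+ r) ℚ.* 1ℚ                                      ≡⟨ cong (λ t → ι (+ r) ℚ.* t) (1^ q) ⟨
    ι (+ r) ℚ.* 1ℚ ^ℚ q                                 ≡⟨ cong (λ t → ι (+ r) ℚ.* t ^ℚ q) (suc*step k) ⟨
    ι (+ r) ℚ.* (ι (+ suc k) ℚ.* step k) ^ℚ q           ≡⟨ cong (λ t → ι (+ r) ℚ.* t) (scale-^ (suc k) k) ⟩
    ι (+ r) ℚ.* (ι (+ (suc k ℕ.^ q)) ℚ.* step k ^ℚ q)   ≡⟨ ℚ.*-assoc (ι (+ r)) (ι (+ (suc k ℕ.^ q))) (step k ^ℚ q) ⟨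
    ι (+ r) ℚ.* ι (+ (suc k ℕ.^ q)) ℚ.* step k ^ℚ q     ≡⟨ cong (λ t → t ℚ.* step k ^ℚ q)
      (trans (cong ι (ℤ.pos-* r (suc k ℕ.^ q))) (ι-* (+ r) (+ (suc k ℕ.^ q)))) ⟨
    ι (+ (r ℕ.* suc k ℕ.^ q)) ℚ.* step k ^ℚ q           ∎
    where open ≡-Reasoning

  u^q≤r : ∀ k → u k ^ℚ q ℚ.≤ ι (+ r)
  u^q≤r k = subst₂ ℚ._≤_ (sym (scale-^ (j k) k)) (sym (r-scaled k))
    (*-monoʳ (step k ^ℚ q) (^-nonNeg (step k) q (ℚ.<⇒≤ (0<step k))) (ι-mono (proj₁ (proj₂ (scaled k)))))

  u+step : ∀ k → u k ℚ.+ step k ≡ ι (+ suc (j k)) ℚ.* step k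
  u+step k = begin
    ι (+ j k) ℚ.* step k ℚ.+ step k               ≡⟨ regroup (ι (+ j k)) (step k) ⟩
    (1ℚ ℚ.+ ι (+ j k)) ℚ.* step k                 ≡⟨ cong (λ t → t ℚ.* step k) (ι-+ 1ℤ (+ j k)) ⟨
    ι (+ suc (j k)) ℚ.* step k                    ∎
    where
    open ≡-Reasoning
    regroup : ∀ a h → a ℚ.* h ℚ.+ h ≡ (1ℚ ℚ.+ a) ℚ.* h
    regroup = solve 2 (λ a h → a :* h :+ h := (con 1ℚ :+ a) :* h) refl
      where open ℚ-Syntax

  r<[u+step]^q : ∀ k → ι (+ r) ℚ.< (u k ℚ.+ step k) ^ℚ q
  r<[u+step]^q k = subst₂ ℚ._<_ (sym (r-scaled k))
    (sym (trans (cong (λ t → t ^ℚ q) (u+step k)) (scale-^ (suc (j k)) k)))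
    (ℚ.*-monoˡ-<-pos (step k ^ℚ q) {{ℚ.positive (^-pos (step k) q (0<step k))}}
      (ι-mono-< (proj₂ (proj₂ (scaled k)))))

  below-root : ∀ a k → a ^ℚ q ℚ.≤ ι (+ r) → a ℚ.≤ u k ℚ.+ step k
  below-root a k a^q≤r = ℚ.<⇒≤ (^-cancel-< a (u k ℚ.+ step k) q (0≤u+step k)
    (ℚ.≤-<-trans a^q≤r (r<[u+step]^q k)))

  below-root-ev : ∀ a ε → a ^ℚ q ℚ.≤ ι (+ r) → 0ℚ ℚ.< ε →
    ∃[ N ] ∀ k → N ℕ.≤ k → a ℚ.≤ u k ℚ.+ ε
  below-root-ev a ε a^q≤r 0<ε = let N , h = step-small ε 0<ε in N , λ k k≥ →
    ℚ.≤-trans (below-root a k a^q≤r) (ℚ.+-monoʳ-≤ (u k) (h k k≥))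

  root : ℝ
  seq    root = u
  cauchy root ε 0<ε = let N , h = step-small ε 0<ε in N , λ m n m≥ n≥ →
    dist-bound (u m) (u n) ε
      (ℚ.≤-trans (below-root (u m) n (u^q≤r m)) (ℚ.+-monoʳ-≤ (u n) (h n n≥)))
      (ℚ.≤-trans (below-root (u n) m (u^q≤r n)) (ℚ.+-monoʳ-≤ (u m) (h m m≥)))

  0<root : fromℕ 0 < root
  -- The root is at least 1; half of that is given up to the approximation, and the other half is
  -- the gap above zero.
  0<root = ½ , ℚ.positive⁻¹ ½ , map₂ (λ h k k≥ → subst₂ ℚ._≤_ refl (cancel (u k))
      (ℚ.+-monoˡ-≤ (ℚ.- ½) (h k k≥)))
    (below-root-ev 1ℚ ½ (subst (λ t → t ℚ.≤ ι (+ r)) (sym (1^ q)) (ι-mono 1≤r)) (ℚ.positive⁻¹ ½))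
    where
    cancel : ∀ a → a ℚ.+ ½ ℚ.- ½ ≡ a
    cancel a = trans (ℚ.+-assoc a ½ (ℚ.- ½)) (ℚ.+-identityʳ a)

  root-^ : Null (λ k → u k ^ℚ q ℚ.- ι (+ r))
  root-^ ε 0<ε =
    let δ , 0<δ , small = small-factor K ε (lipschitz-nonNeg B q 0≤B) 0<ε
        M , step≤1      = step-small 1ℚ 0<1ℚ
        N , step≤δ      = step-small δ 0<δ
    in M ℕ.+ N , λ k k≥ → dist-bound (u k ^ℚ q) (ι (+ r)) ε
      (ℚ.≤-trans (u^q≤r k) (subst (λ t → t ℚ.≤ ι (+ r) ℚ.+ ε) (ℚ.+-identityʳ (ι (+ r)))
        (ℚ.+-monoʳ-≤ (ι (+ r)) (ℚ.<⇒≤ 0<ε))))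
      (begin
        ι (+ r)                                    ≤⟨ ℚ.<⇒≤ (r<[u+step]^q k) ⟩
        (u k ℚ.+ step k) ^ℚ q                      ≤⟨ ^-lipschitz (u k) (u k ℚ.+ step k) B q (0≤u k)
          (subst (λ t → t ℚ.≤ u k ℚ.+ step k) (ℚ.+-identityʳ (u k)) (ℚ.+-monoʳ-≤ (u k) (ℚ.<⇒≤ (0<step k))))
          (ℚ.+-mono-≤ (below-root (u k) 0 (u^q≤r k)) (step≤1 k (ℕ.≤-trans (ℕ.m≤m+n M N) k≥))) ⟩
        u k ^ℚ q ℚ.+ (u k ℚ.+ step k ℚ.- u k) ℚ.* K
          ≡⟨ cong (λ t → u k ^ℚ q ℚ.+ t ℚ.* K) (cancel (u k) (step k)) ⟩
        u k ^ℚ q ℚ.+ step k ℚ.* K                  ≤⟨ ℚ.+-monoʳ-≤ (u k ^ℚ q)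
          (small (step k) (ℚ.<⇒≤ (0<step k)) (step≤δ k (ℕ.≤-trans (ℕ.m≤n+m N M) k≥))) ⟩
        u k ^ℚ q ℚ.+ ε                             ∎)
    where
    open ℚ.≤-Reasoning
    -- A bound for `u k + step k` at late `k`: every `u k` lies below `u 0 + step 0`, and `step k`
    -- is eventually at most 1.
    B = u 0 ℚ.+ step 0 ℚ.+ 1ℚ
    0≤B : 0ℚ ℚ.≤ B
    0≤B = +-nonNeg (u 0 ℚ.+ step 0) 1ℚ (0≤u+step 0) 0≤1
    K = lipschitz B q
    cancel : ∀ a h → a ℚ.+ h ℚ.- a ≡ h
    cancel = solve 2 (λ a h → a :+ h :- a := h) refl
      where open ℚ-Syntax

-- Comparing powers of 7 with n^(log₂ 7).

null-≤ : ∀ {a b} (f : ℕ → ℚ) → (∃[ N ] ∀ n → N ℕ.≤ n → a ℚ.≤ f n) → Null (λ n → f n ℚ.- b) → a ℚ.≤ b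
null-≤ {a} {b} f (M , a≤f) f→b = ℚ.≮⇒≥ λ b<a →
  let e       = (a ℚ.- b) ℚ.* ½
      0<a-b   = 0<q-p {b} {a} b<a
      N , h   = f→b e (halve {a ℚ.- b} 0<a-b)
      k       = M ℕ.+ N
  in ℚ.<-irrefl {a} refl (begin-strict
    a                ≤⟨ a≤f k (ℕ.m≤m+n M N) ⟩
    f k              ≤⟨ dist-≤ (f k) b {e} (h k (ℕ.m≤n+m N M)) ⟩
    b ℚ.+ e          <⟨ ℚ.+-monoʳ-< b (half-< {a ℚ.- b} 0<a-b) ⟩
    b ℚ.+ (a ℚ.- b)  ≡⟨ cancel a b ⟩
    a                ∎)
  where
  open ℚ.≤-Reasoning
  cancel : ∀ a b → b ℚ.+ (a ℚ.- b) ≡ a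
  cancel = solve 2 (λ a b → b :+ (a :- b) := a) refl
    where open ℚ-Syntax

-- Continuity of the power at `b`, through the Lipschitz bound. The requirement that `w` be at least
-- 1 prepares `^-gap` and disposes of negative exponents.
approximate-from-below : ∀ b e ε → 1ℚ ℚ.< b → 0ℚ ℚ.< ε →
  ∃[ w ] 1ℚ ℚ.≤ w × w ℚ.< b × b ^ℚ e ℚ.≤ w ^ℚ e ℚ.+ ε
approximate-from-below b e ε 1<b 0<ε =
  let δ , 0<δ , small = small-factor (lipschitz b e) ε (lipschitz-nonNeg b e 0≤b) 0<ε
      h , 0<h , h≤δ , h≤b-1 = pick δ (b ℚ.- 1ℚ) 0<δ (0<q-p {1ℚ} {b} 1<b)
      1≤b-h : 1ℚ ℚ.≤ b ℚ.- h
      1≤b-h = subst₂ ℚ._≤_ (cancel₁ 1ℚ h) (cancel₂ b h) (ℚ.+-monoˡ-≤ (1ℚ ℚ.- h) h≤b-1)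
      b-h<b : b ℚ.- h ℚ.< b
      b-h<b = subst (λ t → b ℚ.- h ℚ.< t) (ℚ.+-identityʳ b) (ℚ.+-monoʳ-< b (ℚ.neg-antimono-< 0<h))
  in b ℚ.- h , 1≤b-h , b-h<b , ℚ.≤-trans
    (^-lipschitz (b ℚ.- h) b b e (ℚ.≤-trans 0≤1 1≤b-h) (ℚ.<⇒≤ b-h<b) ℚ.≤-refl)
    (ℚ.+-monoʳ-≤ ((b ℚ.- h) ^ℚ e) (subst (λ t → t ℚ.* lipschitz b e ℚ.≤ ε) (sym (cancel₃ b h))
      (small h (ℚ.<⇒≤ 0<h) h≤δ)))
  where
  open ℚ-Syntax
  0≤b : 0ℚ ℚ.≤ b
  0≤b = ℚ.≤-trans 0≤1 (ℚ.<⇒≤ 1<b)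
  pick : ∀ p q → 0ℚ ℚ.< p → 0ℚ ℚ.< q → ∃[ h ] 0ℚ ℚ.< h × h ℚ.≤ p × h ℚ.≤ q
  pick p q 0<p 0<q with ℚ.≤-total p q
  ... | inj₁ p≤q = p , 0<p , ℚ.≤-refl , p≤q
  ... | inj₂ q≤p = q , 0<q , q≤p , ℚ.≤-refl
  cancel₁ : ∀ o h → h ℚ.+ (o ℚ.- h) ≡ o
  cancel₁ = solve 2 (λ o h → h :+ (o :- h) := o) refl
  cancel₂ : ∀ b h → b ℚ.- 1ℚ ℚ.+ (1ℚ ℚ.- h) ≡ b ℚ.- h
  cancel₂ = solve 2 (λ b h → b :- con 1ℚ :+ (con 1ℚ :- h) := b :- h) refl
  cancel₃ : ∀ b h → b ℚ.- (b ℚ.- h) ≡ h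
  cancel₃ = solve 2 (λ b h → b :- (b :- h) := h) refl

-- The factor `w ^ℚ e` is at least 1, so a gap η between bases survives undiminished between their
-- powers.
^-gap : ∀ w η e → 1ℚ ℚ.≤ w → 0ℚ ℚ.≤ η → w ^ℚ suc e ℚ.+ η ℚ.≤ (w ℚ.+ η) ^ℚ suc e
^-gap w η e 1≤w 0≤η = begin
  w ^ℚ suc e ℚ.+ η                     ≡⟨ cong (λ t → w ^ℚ suc e ℚ.+ t) (ℚ.*-identityʳ η) ⟨
  w ℚ.* w ^ℚ e ℚ.+ η ℚ.* 1ℚ            ≤⟨ ℚ.+-monoʳ-≤ (w ℚ.* w ^ℚ e) (*-monoˡ η 0≤η (1≤^ w e 1≤w)) ⟩
  w ℚ.* w ^ℚ e ℚ.+ η ℚ.* w ^ℚ e        ≡⟨ ℚ.*-distribʳ-+ (w ^ℚ e) w η ⟨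
  (w ℚ.+ η) ℚ.* w ^ℚ e                 ≤⟨ *-monoˡ (w ℚ.+ η) (+-nonNeg w η 0≤w 0≤η)
                                            (^-mono-≤ w (w ℚ.+ η) e 0≤w w≤w+η) ⟩
  (w ℚ.+ η) ^ℚ suc e                   ∎
  where
  open ℚ.≤-Reasoning
  0≤w = ℚ.≤-trans 0≤1 1≤w
  w≤w+η : w ℚ.≤ w ℚ.+ η
  w≤w+η = subst (λ t → t ℚ.≤ w ℚ.+ η) (ℚ.+-identityʳ w) (ℚ.+-monoʳ-≤ w 0≤η)

fromℕ-^ : ∀ b p k → seq (fromℕ b ^ p) k ≡ ι (+ (b ℕ.^ p))
fromℕ-^ b p k = trans (seq-^ (fromℕ b) p k) (sym (ι-^ b p))

ratPow-of-ℕ : ∀ n p q-1 .(c : Coprime p (suc q-1)) → 1 ℕ.≤ n →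
  ∃[ x ] IsRatPow (fromℕ n) (mkℚ (+ p) q-1 c) x ×
  (∀ a ε → a ^ℚ suc q-1 ℚ.≤ ι (+ (n ℕ.^ p)) → 0ℚ ℚ.< ε →
    ∃[ N ] ∀ k → N ℕ.≤ k → a ℚ.≤ seq x k ℚ.+ ε)
ratPow-of-ℕ n p q-1 c 1≤n = root ,
  (0<root , null-cong
    (λ k → cong₂ ℚ._-_ (sym (seq-^ root (suc q-1) k)) (sym (fromℕ-^ n p k))) root-^) ,
  below-root-ev
  where open Root (n ℕ.^ p) q-1 (ℕ.m^n>0 n {{ℕ.>-nonZero 1≤n}} p)

-- If y were less than 7ᵉ, some rational w < 7 would satisfy y < wᵉ; then
-- for every t ≤ α, 2ᵗ ≤ w, since otherwise nᵗ ≥ (2ᵗ)ᵉ > wᵉ > y.  So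
-- 7 = sup 2ᵗ would be at most w.
power-bound : ∀ n e → 2 ℕ.^ suc e ℕ.≤ n → ∀ α y → IsLog (fromℕ 2) (fromℕ 7) α →
  IsPow (fromℕ n) α y → fromℕ (7 ℕ.^ suc e) ≤ y
power-bound n e-1 2^e≤n α y (_ , 7-least) (y-upper , _) (ε , 0<ε , N , y+ε≤7^e) =
  7-least (fromℚ w) w-upper (7-w , 0<q-p {w} {seven} w<7 , 0 , λ _ _ → ℚ.≤-reflexive (restore w seven))
  where
  open ℚ-Syntax
  e = suc e-1
  seven = ι (+ 7)
  approx = approximate-from-below seven e ε (ι-mono-< {1} {7} (ℕ.s≤s (ℕ.s≤s ℕ.z≤n))) 0<ε
  w = proj₁ approx
  1≤w = proj₁ (proj₂ approx)
  w<7 = proj₁ (proj₂ (proj₂ approx))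
  7^e≤w^e+ε = proj₂ (proj₂ (proj₂ approx))
  7-w = seven ℚ.- w
  restore : ∀ w s → w ℚ.+ (s ℚ.- w) ≡ s
  restore = solve 2 (λ w s → w :+ (s :- w) := s) refl
  0≤w = ℚ.≤-trans 0≤1 1≤w
  1≤n : 1 ℕ.≤ n
  1≤n = ℕ.≤-trans (ℕ.m^n>0 2 e) 2^e≤n
  y≤w^e : ∀ k → N ℕ.≤ k → seq y k ℚ.≤ w ^ℚ e
  y≤w^e k k≥ = subst₂ ℚ._≤_ (cancel (seq y k) ε) (cancel (w ^ℚ e) ε)
    (ℚ.+-monoˡ-≤ (ℚ.- ε) (ℚ.≤-trans (y+ε≤7^e k k≥)
      (subst (λ t → t ℚ.≤ w ^ℚ e ℚ.+ ε) (sym (ι-^ 7 e)) 7^e≤w^e+ε)))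
    where
    cancel : ∀ a e → a ℚ.+ e ℚ.- e ≡ a
    cancel = solve 2 (λ a e → a :+ e :- e := a) refl
  z^-≥ : ∀ z W M q → 0ℚ ℚ.≤ W → (∀ k → M ℕ.≤ k → W ℚ.≤ seq z k) →
    ∀ k → M ℕ.≤ k → W ^ℚ q ℚ.≤ seq (z ^ q) k
  z^-≥ z W M q 0≤W W≤z k k≥ = subst (λ t → W ^ℚ q ℚ.≤ t) (sym (seq-^ z q k))
    (^-mono-≤ W (seq z k) q 0≤W (W≤z k k≥))
  w-upper : ∀ z → ∃[ t ] fromℚ t ≤ α × IsRatPow (fromℕ 2) t z → z ≤ fromℚ w
  w-upper z (t@(mkℚ (+ p) q-1 c) , t≤α , _ , z^q≈2^p) (η , 0<η , M , W≤z) =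
    y-upper x (t , t≤α , x-pow)
      -- Here x = nᵗ reaches `W ^ℚ e` up to η/2, while `W ^ℚ e` exceeds `w ^ℚ e`, and so y, by η;
      -- the remaining η/2 separates y from x.
      (η ℚ.* ½ , halve {η} 0<η , N ℕ.+ proj₁ near , λ k k≥ → gap k
        (ℕ.≤-trans (ℕ.m≤m+n N _) k≥)
        (proj₂ near k (ℕ.≤-trans (ℕ.m≤n+m (proj₁ near) N) k≥)))
    where
    q = suc q-1
    W = w ℚ.+ η
    0≤W : 0ℚ ℚ.≤ W
    0≤W = +-nonNeg w η 0≤w (ℚ.<⇒≤ 0<η)
    power = ratPow-of-ℕ n p q-1 c 1≤n
    x = proj₁ power
    x-pow = proj₁ (proj₂ power)
    W^q≤2^p : W ^ℚ q ℚ.≤ ι (+ (2 ℕ.^ p))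
    W^q≤2^p = null-≤ (seq (z ^ q)) (M , z^-≥ z W M q 0≤W W≤z)
      (null-cong (λ k → cong (λ t → seq (z ^ q) k ℚ.- t) (fromℕ-^ 2 p k)) z^q≈2^p)
    2^pe≤n^p : (2 ℕ.^ p) ℕ.^ e ℕ.≤ n ℕ.^ p
    2^pe≤n^p = begin
      (2 ℕ.^ p) ℕ.^ e   ≡⟨ ℕ.^-*-assoc 2 p e ⟩
      2 ℕ.^ (p ℕ.* e)   ≡⟨ cong (2 ℕ.^_) (ℕ.*-comm p e) ⟩
      2 ℕ.^ (e ℕ.* p)   ≡⟨ ℕ.^-*-assoc 2 e p ⟨
      (2 ℕ.^ e) ℕ.^ p   ≤⟨ ℕ.^-monoˡ-≤ p 2^e≤n ⟩
      n ℕ.^ p           ∎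
      where open ℕ.≤-Reasoning
    W^e^q≤n^p : (W ^ℚ e) ^ℚ q ℚ.≤ ι (+ (n ℕ.^ p))
    W^e^q≤n^p = begin
      (W ^ℚ e) ^ℚ q               ≡⟨ ^-comm W e q ⟩
      (W ^ℚ q) ^ℚ e               ≤⟨ ^-mono-≤ (W ^ℚ q) (ι (+ (2 ℕ.^ p))) e (^-nonNeg W q 0≤W) W^q≤2^p ⟩
      ι (+ (2 ℕ.^ p)) ^ℚ e        ≡⟨ ι-^ (2 ℕ.^ p) e ⟨
      ι (+ ((2 ℕ.^ p) ℕ.^ e))     ≤⟨ ι-mono 2^pe≤n^p ⟩
      ι (+ (n ℕ.^ p))             ∎
      where open ℚ.≤-Reasoning
    near = proj₂ (proj₂ power) (W ^ℚ e) (η ℚ.* ½) W^e^q≤n^p (halve {η} 0<η)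
    gap : ∀ k → N ℕ.≤ k → W ^ℚ e ℚ.≤ seq x k ℚ.+ η ℚ.* ½ → seq y k ℚ.+ η ℚ.* ½ ℚ.≤ seq x k
    gap k k≥ W^e≤x = subst₂ ℚ._≤_
      (trans (cong (λ t → seq y k ℚ.+ t ℚ.- h) (sym (two-halves η))) (left (seq y k) h)) (right (seq x k) h)
      (ℚ.+-monoˡ-≤ (ℚ.- h) (begin
        seq y k ℚ.+ η      ≤⟨ ℚ.+-monoˡ-≤ η (y≤w^e k k≥) ⟩
        w ^ℚ e ℚ.+ η       ≤⟨ ^-gap w η e-1 1≤w (ℚ.<⇒≤ 0<η) ⟩
        W ^ℚ e             ≤⟨ W^e≤x ⟩
        seq x k ℚ.+ h      ∎))
      where
      open ℚ.≤-Reasoning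
      h = η ℚ.* ½
      left : ∀ a h → a ℚ.+ (h ℚ.+ h) ℚ.- h ≡ a ℚ.+ h
      left = solve 2 (λ a h → a :+ (h :+ h) :- h := a :+ h) refl
      right : ∀ a h → a ℚ.+ h ℚ.- h ≡ a
      right = solve 2 (λ a h → a :+ h :- h := a) refl
  -- For negative t the power 2ᵗ is below 1 ≤ w: otherwise z^q times 2^(p+1) would be at least 2,
  -- whereas it is 1.
  w-upper z (mkℚ -[1+ p ] q-1 _ , _ , _ , z^q*2^p≈1) (η , 0<η , M , W≤z) =
    ≤⇒≯ 2^p≤1 (ι-mono-< {1} {2 ℕ.^ suc p} (ℕ.≤-trans (ℕ.s≤s (ℕ.s≤s ℕ.z≤n)) (ℕ.*-monoʳ-≤ 2 (ℕ.m^n>0 2 p))))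
    where
    q = suc q-1
    T = ι (+ (2 ℕ.^ suc p))
    1≤z : ∀ k → M ℕ.≤ k → 1ℚ ℚ.≤ seq z k
    1≤z k k≥ = ℚ.≤-trans 1≤w (ℚ.≤-trans
      (subst (λ t → t ℚ.≤ w ℚ.+ η) (ℚ.+-identityʳ w) (ℚ.+-monoʳ-≤ w (ℚ.<⇒≤ 0<η))) (W≤z k k≥))
    2^p≤1 : T ℚ.≤ ι (+ 1)
    2^p≤1 = null-≤ (λ k → seq (z ^ q) k ℚ.* T)
      (M , λ k k≥ → subst (λ t → t ℚ.≤ seq (z ^ q) k ℚ.* T) (ℚ.*-identityˡ T)
        (*-monoʳ T (ι-mono {0} {2 ℕ.^ suc p} ℕ.z≤n)
          (subst (λ t → t ℚ.≤ seq (z ^ q) k) (1^ q) (z^-≥ z 1ℚ M q 0≤1 1≤z k k≥))))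
      (null-cong {λ k → seq (z ^ q * fromℕ 2 ^ suc p) k ℚ.- ι (+ 1)} {λ k → seq (z ^ q) k ℚ.* T ℚ.- ι (+ 1)}
        (λ k → cong (λ t → seq (z ^ q) k ℚ.* t ℚ.- ι (+ 1)) (fromℕ-^ 2 (suc p) k)) z^q*2^p≈1)

≤-scale : ∀ c m k y → m ℕ.≤ suc c ℕ.* k → fromℕ k ≤ y → fromℕ m ≤ fromℕ (suc c) * y
≤-scale c m k y m≤ck k≤y (ε , 0<ε , N , h) =
  let δ , 0<δ , cδ≡ε = divide C 0<C ε 0<ε
  in k≤y (δ , 0<δ , N , λ i i≥ → ℚ.*-cancelˡ-≤-pos {seq y i ℚ.+ δ} {ι (+ k)} C {{ℚ.positive 0<C}} (begin
    C ℚ.* (seq y i ℚ.+ δ)         ≡⟨ ℚ.*-distribˡ-+ C (seq y i) δ ⟩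
    C ℚ.* seq y i ℚ.+ C ℚ.* δ     ≡⟨ cong (λ t → C ℚ.* seq y i ℚ.+ t) cδ≡ε ⟩
    C ℚ.* seq y i ℚ.+ ε           ≤⟨ h i i≥ ⟩
    ι (+ m)                       ≤⟨ ι-mono m≤ck ⟩
    ι (+ (suc c ℕ.* k))           ≡⟨ trans (cong ι (ℤ.pos-* (suc c) k)) (ι-* (+ suc c) (+ k)) ⟩
    C ℚ.* ι (+ k)                 ∎))
  where
  open ℚ.≤-Reasoning
  C = ι (+ suc c)
  0<C = 0<ι-suc c

theorem2p14 : ∃[ C ] ∃[ n₀ ] ∀ (n : ℕ) → n₀ ℕ.≤ n →
    ¬ ¬ (∃[ m ] IsAgen n m ×
    (∀ (α y : ℝ) → IsLog (fromℕ 2) (fromℕ 7) α → IsPow (fromℕ n) α y →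
    fromℕ m ≤ C * y))
-- From n = 2 on, the exponent e with 2ᵉ ≤ n < 2ᵉ⁺¹ is positive, the form in which `power-bound`
-- takes it.
theorem2p14 = fromℕ 7 , 2 , λ n 2≤n → bound n 2≤n
    (bracket (2 ℕ.^_) (λ j → ℕ.^-monoʳ-< 2 (ℕ.s≤s (ℕ.s≤s ℕ.z≤n)) (ℕ.n<1+n j)) n
      (ℕ.≤-trans (ℕ.s≤s ℕ.z≤n) 2≤n))
  where
  bound : ∀ n → 2 ℕ.≤ n → ∃[ e ] 2 ℕ.^ e ℕ.≤ n × n ℕ.< 2 ℕ.^ suc e →
    ¬ ¬ (∃[ m ] IsAgen n m ×
      (∀ (α y : ℝ) → IsLog (fromℕ 2) (fromℕ 7) α → IsPow (fromℕ n) α y → fromℕ m ≤ fromℕ 7 * y))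
  bound n 2≤n (zero  , _     , n<2)       _  = contradiction n<2 (ℕ.≤⇒≯ 2≤n)
  bound n 2≤n (suc e , 2^e≤n , n<2^[1+e]) ¬m =
    Agen-bound n (suc (suc e)) (ℕ.<⇒≤ n<2^[1+e]) λ (m , m≤ , agen) →
      ¬m (m , agen , λ α y log pow →
        -- `≤-scale` takes the predecessor of the factor, so `6` stands for 7; the bound 7ᵉ⁺²
        -- unfolds to 7 times 7ᵉ⁺¹.
        ≤-scale 6 m (7 ℕ.^ suc e) y m≤ (power-bound n e 2^e≤n α y log pow))
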